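{- Let $P$ be a bounded interval order of length at least $2$, let $A$ be its set of atoms, and let $a_0$ be its smallest atom, i.e. the unique minimum element of $A$ with respect to the partial order $\preceq$ on $A$ whose strict relation is: $a\prec b$ if $a$ has a cover in $P$ that is not greater than $b$. Then for all $i\ge 0$, $$\beta_i(P)=\sum_{a\in A\setminus\{a_0\}}\beta_{i-1}([a,\hat 1]).$$
   Context: All posets are finite. A poset is bounded if it has a minimum element $\hat 0$ and a maximum element $\hat 1$. The length of a bounded poset is the length (number of covering steps) of its longest chain from $\hat 0$ to $\hat 1$. Atoms are the elements covering $\hat 0$. A poset $P$ is an interval order if its elements $x$ can be assigned closed intervals $I_x$ of the real line so that $x<y$ in $P$ if and only if $\max I_x<\min I_y$; by a well-known characterization, this is equivalent to $P$ not containing, as an induced subposet, the $4$-element poset consisting of two disjoint $2$-element chains (with no relations between the two chains). The relation $\prec$ on the atoms of a bounded interval order is a strict partial order, and "the smallest atom" means the unique minimum atom in the corresponding partial order $\preceq$. For a bounded poset $P$ put $\bar P=P\setminus\{\hat 0,\hat 1\}$, let $\Delta(\bar P)$ be the order complex of $\bar P$ (the simplicial complex of all chains of $\bar P$, including the empty chain), and let $\beta_i(P)$ be the $i$-th reduced Betti number of $\Delta(\bar P)$, i.e. the rank of the reduced simplicial homology group $\tilde H_i(\Delta(\bar P);\mathbb Z)$. In particular, when $\bar P=\emptyset$ one has $\Delta(\bar P)=\{\emptyset\}$, $\beta_{ -1}(P)=1$ and $\beta_i(P)=0$ for $i\neq -1$. The closed interval $[a,\hat 1]=\{x\in P: a\le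 x\le \hat 1\}$ is regarded as a bounded poset with minimum $a$ and maximum $\hat 1$.
   Formalization: The smallest atom need not exist (e.g. two atoms covered only by the maximum element are unrelated), so the theorem is stated for those bounded interval orders whose set of atoms has a minimum a_0 with respect to ⪯; its existence is a hypothesis. -}

module Defs where

open import Algebra.Bundles using (AbelianGroup)
import Algebra.Definitions.RawMonoid as RawMonoidDefs
import Algebra.Properties.Semiring.Sum as SemiringSum
open import Data.Fin.Base using (Fin; zero; suc; toℕ; punchIn; punchOut)
import Data.Fin.Properties as Fin
open import Data.Integer.Base as ℤ using (ℤ; +_; -[1+_]; 0ℤ; 1ℤ; -1ℤ; _+_; _*_; -_)
import Data.Integer.Properties as ℤ
import Data.List.Properties as List
open import Data.Integer.Tactic.RingSolver using (solve-∀)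
open import Data.Irrelevant using ([_])
open import Data.List.Base as List using (List; []; _∷_; _++_)
open import Data.List.Membership.Propositional using (_∈_)
open import Data.List.Membership.Propositional.Properties
  using (∈-cartesianProductWith⁺; ∈-lookup)
open import Data.List.Relation.Unary.All as All using (All; []; _∷_)
import Data.List.Relation.Unary.All.Properties as AllP
open import Data.List.Relation.Unary.AllPairs as AllPairs using ([]; _∷_)
open import Data.List.Relation.Unary.Any using (here; there)
open import Data.List.Relation.Unary.Unique.Propositional using (Unique)
import Data.List.Relation.Unary.Unique.Propositional.Properties as Unique
open import Data.Nat.Base as ℕ using (ℕ; zero; suc)
import Data.Nat.Properties as ℕ
open import Data.Product.Base using (Σ; ∃; _×_; _,_; proj₁; proj₂)
open import Data.Rational.Base as ℚ using (ℚ)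
open import Data.Refinement as Refinement using (Refinement; value; value-injective; _,_)
open import Data.Sum.Base using (_⊎_; inj₁; inj₂)
open import Data.Vec.Base as Vec using (Vec; []; _∷_; removeAt)
import Data.Vec.Properties as Vec
import Data.Vec.Relation.Unary.All as VecAll
import Data.Vec.Relation.Unary.AllPairs as VecAllPairs
open VecAll using ([]; _∷_)
open VecAllPairs using ([]; _∷_)
open import Function.Base using (_∘_)
open import Function.Bundles using (_⇔_)
open import Level using (0ℓ)
open import Relation.Binary.Core using (Rel)
open import Relation.Binary.Construct.Closure.ReflexiveTransitive using (Star; fold)
import Relation.Binary.Construct.NonStrictToStrict as ToStrict
import Relation.Binary.Construct.StrictToNonStrict as ToNonStrict
open import Relation.Binary.Definitions using (Decidable; DecidableEquality; Minimum; Maximum)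
open import Relation.Binary.PropositionalEquality
  using (_≡_; _≢_; _≗_; refl; sym; trans; cong; cong₂; subst; isEquivalence)
open import Relation.Binary.Structures using (IsPartialOrder)
open import Relation.Nullary using (¬_; yes; no; contradiction)
open import Relation.Nullary.Decidable using (map′; recompute; decidable-stable; _×-dec_; ¬?)
open import Relation.Nullary.Negation using (contradiction-irr)
import Relation.Unary as Unary

private
  module ℤSum = SemiringSum ℤ.+-*-semiring

-- The free abelian group on X: a list stands for the sum of its entries n·x, and two
-- lists are equal when all their coefficients agree (_≈_ below).

Formal : Set → Set
Formal X = List (ℤ × X)

private variable
  X Y Z : Set

scale : ℤ → Formal X → Formal X
scale n = List.map λ (m , x) → n * m , x

eval : (X → ℤ) → Formal X → ℤ
eval φ [] = 0ℤ
eval φ ((n , x) ∷ c) = n * φ x + eval φ c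

extend : (X → Formal Y) → Formal X → Formal Y
extend f [] = []
extend f ((n , x) ∷ c) = scale n (f x) ++ extend f c

eval-++ : ∀ (φ : X → ℤ) c d → eval φ (c ++ d) ≡ eval φ c + eval φ d
eval-++ φ [] d = sym (ℤ.+-identityˡ _)
eval-++ φ ((n , x) ∷ c) d =
  trans (cong (λ t → n * φ x + t) (eval-++ φ c d)) (sym (ℤ.+-assoc (n * φ x) _ _))

eval-scale : ∀ (φ : X → ℤ) n c → eval φ (scale n c) ≡ n * eval φ c
eval-scale φ n [] = sym (ℤ.*-zeroʳ n)
eval-scale φ n ((m , x) ∷ c) =
  trans (cong (λ t → n * m * φ x + t) (eval-scale φ n c)) (lemma n m (φ x) (eval φ c))
  where
    lemma : ∀ n m a b → n * m * a + n * b ≡ n * (m * a + b)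
    lemma = solve-∀

eval-extend : ∀ (φ : Y → ℤ) (f : X → Formal Y) c →
  eval φ (extend f c) ≡ eval (λ x → eval φ (f x)) c
eval-extend φ f [] = refl
eval-extend φ f ((n , x) ∷ c) = trans (eval-++ φ (scale n (f x)) _)
  (cong₂ _+_ (eval-scale φ n (f x)) (eval-extend φ f c))

eval-cong : ∀ {φ ψ : X → ℤ} → φ ≗ ψ → ∀ c → eval φ c ≡ eval ψ c
eval-cong h [] = refl
eval-cong h ((n , x) ∷ c) = cong₂ (λ a b → n * a + b) (h x) (eval-cong h c)

eval-0 : ∀ {φ : X → ℤ} → (∀ x → φ x ≡ 0ℤ) → ∀ c → eval φ c ≡ 0ℤ
eval-0 h [] = refl
eval-0 h ((n , x) ∷ c) = cong₂ _+_ (trans (cong (n *_) (h x)) (ℤ.*-zeroʳ n)) (eval-0 h c)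

eval-combine : ∀ p q (φ ψ : X → ℤ) c →
  eval (λ x → p * φ x + q * ψ x) c ≡ p * eval φ c + q * eval ψ c
eval-combine p q φ ψ [] = lemma p q
  where
    lemma : ∀ p q → 0ℤ ≡ p * 0ℤ + q * 0ℤ
    lemma = solve-∀
eval-combine p q φ ψ ((n , x) ∷ c) =
  trans (cong (λ t → n * (p * φ x + q * ψ x) + t) (eval-combine p q φ ψ c))
        (lemma n p q (φ x) (ψ x) (eval φ c) (eval ψ c))
  where
    lemma : ∀ n p q a b s t →
      n * (p * a + q * b) + (p * s + q * t) ≡ p * (n * a + s) + q * (n * b + t)
    lemma = solve-∀

module Coefficients {X : Set} (_≟_ : DecidableEquality X) where

  δ : X → X → ℤ
  δ x y with x ≟ y
  ... | yes _ = 1ℤ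
  ... | no  _ = 0ℤ

  coeff : X → Formal X → ℤ
  coeff x = eval (δ x)

  infix 4 _≈_
  _≈_ : Rel (Formal X) 0ℓ
  c ≈ d = ∀ x → coeff x c ≡ coeff x d

  δ-diag : ∀ x → δ x x ≡ 1ℤ
  δ-diag x with x ≟ x
  ... | yes _ = refl
  ... | no x≢x = contradiction refl x≢x

  δ-off : ∀ {x y} → x ≢ y → δ x y ≡ 0ℤ
  δ-off {x} {y} x≢y with x ≟ y
  ... | yes x≡y = contradiction x≡y x≢y
  ... | no _ = refl

record IsFinite (X : Set) : Set where
  field
    _≟_      : DecidableEquality X
    elements : List X
    unique   : Unique elements
    complete : ∀ x → x ∈ elements

  open Coefficients _≟_ public

  private
    dual-sum : (X → ℤ) → List X → X → ℤ
    dual-sum φ [] y = 0ℤ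
    dual-sum φ (x ∷ xs) y = φ x * δ x y + 1ℤ * dual-sum φ xs y

    dual-sum-0 : ∀ φ {xs y} → All (y ≢_) xs → dual-sum φ xs y ≡ 0ℤ
    dual-sum-0 φ [] = refl
    dual-sum-0 φ {x ∷ xs} (y≢x ∷ h) rewrite δ-off (y≢x ∘ sym) | dual-sum-0 φ h
      | ℤ.*-zeroʳ (φ x) = refl

    dual-sum-∈ : ∀ φ {xs y} → Unique xs → y ∈ xs → dual-sum φ xs y ≡ φ y
    dual-sum-∈ φ (x∉ ∷ u) (here {x} refl) rewrite δ-diag x | dual-sum-0 φ x∉ = lemma (φ x)
      where
        lemma : ∀ a → a * 1ℤ + 1ℤ * 0ℤ ≡ a
        lemma = solve-∀
    dual-sum-∈ φ {x ∷ xs} {y} (x∉ ∷ u) (there y∈)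
      rewrite δ-off (All.lookup x∉ y∈) | dual-sum-∈ φ u y∈ = lemma (φ x) (φ y)
      where
        lemma : ∀ a b → a * 0ℤ + 1ℤ * b ≡ b
        lemma = solve-∀

    eval-dual-sum : ∀ φ xs {c d} → c ≈ d → eval (dual-sum φ xs) c ≡ eval (dual-sum φ xs) d
    eval-dual-sum φ [] {c} {d} _ = trans (eval-0 (λ _ → refl) c) (sym (eval-0 (λ _ → refl) d))
    eval-dual-sum φ (x ∷ xs) {c} {d} h =
      trans (eval-combine (φ x) 1ℤ (δ x) _ c)
      (trans (cong₂ (λ a b → φ x * a + 1ℤ * b) (h x) (eval-dual-sum φ xs {c} {d} h))
      (sym (eval-combine (φ x) 1ℤ (δ x) _ d)))

  eval-≈ : ∀ φ {c d} → c ≈ d → eval φ c ≡ eval φ d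
  eval-≈ φ {c} {d} h =
    trans (eval-cong (λ y → sym (dual-sum-∈ φ unique (complete y))) c)
    (trans (eval-dual-sum φ elements {c} {d} h)
    (eval-cong (λ y → dual-sum-∈ φ unique (complete y)) d))

-- Dedekind reals, with just the order needed to speak about intervals.

record ℝ : Set₁ where
  field
    L U         : ℚ → Set
    L-inhabited : ∃ L
    U-inhabited : ∃ U
    L-rounded   : ∀ q → L q ⇔ (∃ λ r → q ℚ.< r × L r)
    U-rounded   : ∀ q → U q ⇔ (∃ λ r → r ℚ.< q × U r)
    disjoint    : ∀ q → ¬ (L q × U q)
    located     : ∀ {q r} → q ℚ.< r → L q ⊎ U r

infix 4 _<ᴿ_ _≤ᴿ_

_<ᴿ_ : ℝ → ℝ → Set
x <ᴿ y = ∃ λ q → ℝ.U x q × ℝ.L y q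

_≤ᴿ_ : ℝ → ℝ → Set
x ≤ᴿ y = ∀ q → ℝ.L x q → ℝ.L y q

record ClosedInterval : Set₁ where
  field
    min max : ℝ
    min≤max : min ≤ᴿ max

record FinitePoset : Set₁ where
  infix 4 _≤_
  field
    Carrier        : Set
    isFinite       : IsFinite Carrier
    _≤_            : Rel Carrier 0ℓ
    _≤?_           : Decidable _≤_
    isPartialOrder : IsPartialOrder _≡_ _≤_

  open IsFinite isFinite public using (_≟_; elements; unique; complete)
  open IsPartialOrder isPartialOrder public using ()
    renaming (refl to ≤-refl; reflexive to ≤-reflexive; trans to ≤-trans; antisym to ≤-antisym)

  open ToStrict _≡_ _≤_ public using (_<_)

  infix 4 _<?_ _⋖_ _⋖?_

  _<?_ : Decidable _<_
  _<?_ = ToStrict.<-decidable _≡_ _≤_ _≟_ _≤?_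

  _⋖_ : Rel Carrier 0ℓ
  x ⋖ y = x < y × (∀ z → ¬ (x < z × z < y))

  _⋖?_ : Decidable _⋖_
  x ⋖? y = x <? y ×-dec
    map′ (λ h z → All.lookup h (complete z)) (λ h → All.tabulate λ {z} _ → h z)
         (All.all? (λ z → ¬? (x <? z ×-dec z <? y)) elements)

  IsIntervalOrder : Set₁
  IsIntervalOrder = Σ (Carrier → ClosedInterval) λ I →
    ∀ x y → x < y ⇔ ClosedInterval.max (I x) <ᴿ ClosedInterval.min (I y)

module _ {A : Set} {P : A → Set} (P? : Unary.Decidable P) where

  refinements : List A → List (Refinement A P)
  refinements [] = []
  refinements (x ∷ xs) with P? x
  ... | yes p = (x , [ p ]) ∷ refinements xs
  ... | no  _ = refinements xs

  refinements-∈ : ∀ {xs} (y : Refinement A P) → value y ∈ xs → y ∈ refinements xs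
  refinements-∈ {x ∷ xs} y y∈ with P? x | y∈
  ... | yes p | here refl = here (value-injective refl)
  ... | yes p | there y∈′ = there (refinements-∈ y y∈′)
  ... | no ¬p | there y∈′ = refinements-∈ y y∈′
  refinements-∈ {x ∷ xs} (.x , [ p ]) y∈ | no ¬p | here refl = contradiction-irr p ¬p

  refinements-unique : ∀ {xs} → Unique xs → Unique (refinements xs)
  refinements-unique [] = []
  refinements-unique {x ∷ xs} (x∉ ∷ u) with P? x
  ... | no  _ = refinements-unique u
  ... | yes p = fresh x∉ ∷ refinements-unique u
    where
      fresh : ∀ {ys} → All (x ≢_) ys → All ((x , [ p ]) ≢_) (refinements ys)
      fresh [] = []
      fresh {y ∷ ys} (x≢y ∷ h) with P? y
      ... | yes _ = (λ eq → x≢y (cong value eq)) ∷ fresh h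
      ... | no  _ = fresh h

refinement-isFinite : ∀ {A : Set} {P : A → Set} →
  IsFinite A → Unary.Decidable P → IsFinite (Refinement A P)
refinement-isFinite finite P? = record
  { _≟_      = Refinement._≟_ _≟_
  ; elements = refinements P? elements
  ; unique   = refinements-unique P? unique
  ; complete = λ y → refinements-∈ P? y (complete (value y))
  }
  where open IsFinite finite

-- Membership proofs are irrelevant, so equality in an induced subposet is equality in P.

induced : (P : FinitePoset) {S : FinitePoset.Carrier P → Set} → Unary.Decidable S → FinitePoset
induced P {S} S? = record
  { Carrier        = Refinement Carrier S
  ; isFinite       = refinement-isFinite isFinite S?
  ; _≤_            = λ x y → value x ≤ value y
  ; _≤?_           = λ x y → value x ≤? value y
  ; isPartialOrder = record
    { isPreorder = record
      { isEquivalence = isEquivalence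
      ; reflexive     = λ eq → ≤-reflexive (cong value eq)
      ; trans         = ≤-trans
      }
    ; antisym = λ x≤y y≤x → value-injective (≤-antisym x≤y y≤x)
    }
  }
  where open FinitePoset P

record BoundedPoset : Set₁ where
  field
    finitePoset : FinitePoset
  open FinitePoset finitePoset public
  field
    0̂ 1̂     : Carrier
    minimum : Minimum _≤_ 0̂
    maximum : Maximum _≤_ 1̂

  IsAtom : Carrier → Set
  IsAtom a = 0̂ ⋖ a

  isAtom? : Unary.Decidable IsAtom
  isAtom? a = 0̂ ⋖? a

  FullChain : Set
  FullChain = Star _<_ 0̂ 1̂

  steps : FullChain → ℕ
  steps = fold (λ _ _ → ℕ) (λ _ n → suc n) 0

  HasLength : ℕ → Set
  HasLength ℓ = (Σ FullChain λ γ → steps γ ≡ ℓ) × (∀ γ → steps γ ℕ.≤ ℓ)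

  infix 4 _≺_

  _≺_ : Rel Carrier 0ℓ
  a ≺ b = ∃ λ c → a ⋖ c × ¬ (b < c)

  open ToNonStrict _≡_ _≺_ public using () renaming (_≤_ to _≼_)

  IsSmallestAtom : Carrier → Set
  IsSmallestAtom a₀ = IsAtom a₀ × (∀ b → IsAtom b → a₀ ≼ b)

  atomsExcept : Carrier → List Carrier
  atomsExcept a₀ = List.filter (λ a → isAtom? a ×-dec ¬? (a ≟ a₀)) elements

  properPart : FinitePoset
  properPart = induced finitePoset {λ x → x ≢ 0̂ × x ≢ 1̂} λ x → ¬? (x ≟ 0̂) ×-dec ¬? (x ≟ 1̂)

_[_,1̂] : (P : BoundedPoset) → BoundedPoset.Carrier P → BoundedPoset
P [ a ,1̂] = record
  { finitePoset = induced finitePoset {λ x → a ≤ x × x ≤ 1̂} λ x → a ≤? x ×-dec x ≤? 1̂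
  ; 0̂           = a , [ (≤-refl , maximum a) ]
  ; 1̂           = 1̂ , [ (maximum a , ≤-refl) ]
  ; minimum     = λ { (x , [ p ]) → recompute (a ≤? x) (proj₁ p) }
  ; maximum     = λ x → maximum (value x)
  }
  where open BoundedPoset P

-- The rank of an abelian group is the largest size of a ℤ-linearly
-- independent family.

module Rank (G : AbelianGroup 0ℓ 0ℓ) where
  open AbelianGroup G using (Carrier; _≈_; ε; _⁻¹; rawMonoid)
  open RawMonoidDefs rawMonoid using (sum) renaming (_×_ to _×ᴺ_)

  infixr 8 _·_
  _·_ : ℤ → Carrier → Carrier
  (+ n)    · x = n ×ᴺ x
  -[1+ n ] · x = (suc n ×ᴺ x) ⁻¹

  LinearlyIndependent : ∀ {r} → (Fin r → Carrier) → Set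
  LinearlyIndependent v =
    ∀ (c : Fin _ → ℤ) → sum (λ j → c j · v j) ≈ ε → ∀ j → c j ≡ 0ℤ

  IsRank : ℕ → Set
  IsRank r = (∃ λ (v : Fin r → Carrier) → LinearlyIndependent v)
           × (∀ s (v : Fin s → Carrier) → LinearlyIndependent v → s ℕ.≤ r)

  IsRank-unique : ∀ {r s} → IsRank r → IsRank s → r ≡ s
  IsRank-unique ((v , v-ind) , r-max) ((w , w-ind) , s-max) =
    ℕ.≤-antisym (s-max _ v v-ind) (r-max _ w w-ind)

-- ker g / im f, for g ∘ f = 0; f and g are given on basis elements.

module Homology {X Y Z : Set} (f : X → Formal Y) (g : Y → Formal Z)
                (finiteX : IsFinite X) (finiteY : IsFinite Y) (finiteZ : IsFinite Z) where

  private
    module X = IsFinite finiteX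
    module Y = IsFinite finiteY
    module Z = IsFinite finiteZ

  IsCycle : Formal Y → Set
  IsCycle c = extend g c Z.≈ []

  Cycle : Set
  Cycle = Σ (Formal Y) IsCycle

  infix 4 _~_
  _~_ : Rel Cycle 0ℓ
  (c , _) ~ (d , _) = ∃ λ w → c ++ scale -1ℤ d Y.≈ extend f w

  private
    ∂ᶠ : (Y → ℤ) → Formal X → ℤ
    ∂ᶠ φ = eval (λ x → eval φ (f x))

    cycle : ∀ {c} → (∀ z → eval (λ y → Z.coeff z (g y)) c ≡ 0ℤ) → IsCycle c
    cycle {c} h z = trans (eval-extend (Z.δ z) g c) (h z)

    cycle⁻¹ : ∀ {c} → IsCycle c → ∀ z → eval (λ y → Z.coeff z (g y)) c ≡ 0ℤ
    cycle⁻¹ {c} h z = trans (sym (eval-extend (Z.δ z) g c)) (h z)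

    hom : ∀ {c d} w → (∀ φ → eval φ (proj₁ c) + -1ℤ * eval φ (proj₁ d) ≡ ∂ᶠ φ w) → c ~ d
    hom {c , _} {d , _} w h = w , λ y →
      trans (eval-++ (Y.δ y) c _)
      (trans (cong (λ t → eval (Y.δ y) c + t) (eval-scale (Y.δ y) -1ℤ d))
      (trans (h (Y.δ y)) (sym (eval-extend (Y.δ y) f w))))

    hom⁻¹ : ∀ {c d} → ((w , _) : c ~ d) → ∀ φ →
      eval φ (proj₁ c) + -1ℤ * eval φ (proj₁ d) ≡ ∂ᶠ φ w
    hom⁻¹ {c , _} {d , _} (w , h) φ =
      trans (sym (trans (eval-++ φ c _) (cong (λ t → eval φ c + t) (eval-scale φ -1ℤ d))))
      (trans (Y.eval-≈ φ {c ++ scale -1ℤ d} {extend f w} h) (eval-extend φ f w))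

    _⊕_ : Cycle → Cycle → Cycle
    (c , p) ⊕ (d , q) = c ++ d , cycle {c ++ d} λ z →
      trans (eval-++ _ c d) (cong₂ _+_ (cycle⁻¹ {c} p z) (cycle⁻¹ {d} q z))

    ⊖_ : Cycle → Cycle
    ⊖ (c , p) = scale -1ℤ c , cycle {scale -1ℤ c} λ z →
      trans (eval-scale _ -1ℤ c) (cong (-1ℤ *_) (cycle⁻¹ {c} p z))

    0ᶜ : Cycle
    0ᶜ = [] , λ _ → refl

    ~-refl : ∀ {c} → c ~ c
    ~-refl {c} = hom {c} {c} [] λ φ → lemma (eval φ (proj₁ c))
      where
        lemma : ∀ a → a + -1ℤ * a ≡ 0ℤ
        lemma = solve-∀

    ~-sym : ∀ {c d} → c ~ d → d ~ c
    ~-sym {c} {d} e@(w , _) = hom {d} {c} (scale -1ℤ w) λ φ →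
      trans (lemma (eval φ (proj₁ d)) (eval φ (proj₁ c)))
      (trans (cong (-1ℤ *_) (hom⁻¹ {c} {d} e φ)) (sym (eval-scale _ -1ℤ w)))
      where
        lemma : ∀ a b → a + -1ℤ * b ≡ -1ℤ * (b + -1ℤ * a)
        lemma = solve-∀

    ~-trans : ∀ {b c d} → b ~ c → c ~ d → b ~ d
    ~-trans {b} {c} {d} e@(w , _) e′@(w′ , _) = hom {b} {d} (w ++ w′) λ φ →
      trans (lemma (eval φ (proj₁ b)) (eval φ (proj₁ c)) (eval φ (proj₁ d)))
      (trans (cong₂ _+_ (hom⁻¹ {b} {c} e φ) (hom⁻¹ {c} {d} e′ φ)) (sym (eval-++ _ w w′)))
      where
        lemma : ∀ a b c → a + -1ℤ * c ≡ (a + -1ℤ * b) + (b + -1ℤ * c)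
        lemma = solve-∀

    ⊕-cong : ∀ {c d c′ d′} → c ~ d → c′ ~ d′ → c ⊕ c′ ~ d ⊕ d′
    ⊕-cong {c} {d} {c′} {d′} e@(w , _) e′@(w′ , _) = hom {c ⊕ c′} {d ⊕ d′} (w ++ w′) λ φ →
      trans (cong₂ (λ a b → a + -1ℤ * b) (eval-++ φ (proj₁ c) (proj₁ c′)) (eval-++ φ (proj₁ d) (proj₁ d′)))
      (trans (lemma (eval φ (proj₁ c)) (eval φ (proj₁ c′)) (eval φ (proj₁ d)) (eval φ (proj₁ d′)))
      (trans (cong₂ _+_ (hom⁻¹ {c} {d} e φ) (hom⁻¹ {c′} {d′} e′ φ)) (sym (eval-++ _ w w′))))
      where
        lemma : ∀ a a′ b b′ → (a + a′) + -1ℤ * (b + b′) ≡ (a + -1ℤ * b) + (a′ + -1ℤ * b′)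
        lemma = solve-∀

    ⊖-cong : ∀ {c d} → c ~ d → ⊖ c ~ ⊖ d
    ⊖-cong {c} {d} e@(w , _) = hom {⊖ c} {⊖ d} (scale -1ℤ w) λ φ →
      trans (cong₂ (λ a b → a + -1ℤ * b) (eval-scale φ -1ℤ (proj₁ c)) (eval-scale φ -1ℤ (proj₁ d)))
      (trans (lemma (eval φ (proj₁ c)) (eval φ (proj₁ d)))
      (trans (cong (-1ℤ *_) (hom⁻¹ {c} {d} e φ)) (sym (eval-scale _ -1ℤ w))))
      where
        lemma : ∀ a b → -1ℤ * a + -1ℤ * (-1ℤ * b) ≡ -1ℤ * (a + -1ℤ * b)
        lemma = solve-∀

    eval-≡⇒~ : ∀ {c d} → (∀ φ → eval φ (proj₁ c) ≡ eval φ (proj₁ d)) → c ~ d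
    eval-≡⇒~ {c} {d} h = hom {c} {d} [] λ φ →
      trans (cong (λ t → t + -1ℤ * eval φ (proj₁ d)) (h φ)) (lemma (eval φ (proj₁ d)))
      where
        lemma : ∀ a → a + -1ℤ * a ≡ 0ℤ
        lemma = solve-∀

    ⊕-assoc : ∀ b c d → (b ⊕ c) ⊕ d ~ b ⊕ (c ⊕ d)
    ⊕-assoc b c d = eval-≡⇒~ {(b ⊕ c) ⊕ d} {b ⊕ (c ⊕ d)} λ φ →
      cong (eval φ) (List.++-assoc (proj₁ b) (proj₁ c) (proj₁ d))

    ⊕-comm : ∀ c d → c ⊕ d ~ d ⊕ c
    ⊕-comm c d = eval-≡⇒~ {c ⊕ d} {d ⊕ c} λ φ →
      trans (eval-++ φ (proj₁ c) _) (trans (ℤ.+-comm (eval φ (proj₁ c)) _) (sym (eval-++ φ (proj₁ d) _)))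

    ⊕-identityˡ : ∀ c → 0ᶜ ⊕ c ~ c
    ⊕-identityˡ c = eval-≡⇒~ {0ᶜ ⊕ c} {c} λ _ → refl

    ⊕-inverseˡ : ∀ c → (⊖ c) ⊕ c ~ 0ᶜ
    ⊕-inverseˡ c = eval-≡⇒~ {(⊖ c) ⊕ c} {0ᶜ} λ φ →
      trans (eval-++ φ (scale -1ℤ (proj₁ c)) _)
      (trans (cong (λ t → t + eval φ (proj₁ c)) (eval-scale φ -1ℤ (proj₁ c))) (lemma (eval φ (proj₁ c))))
      where
        lemma : ∀ a → -1ℤ * a + a ≡ 0ℤ
        lemma = solve-∀

  homologyGroup : AbelianGroup 0ℓ 0ℓ
  homologyGroup = record
    { Carrier = Cycle
    ; _≈_     = _~_
    ; _∙_     = _⊕_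
    ; ε       = 0ᶜ
    ; _⁻¹     = ⊖_
    ; isAbelianGroup = record
      { isGroup = record
        { isMonoid = record
          { isSemigroup = record
            { isMagma = record
              { isEquivalence = record
                { refl  = λ {c} → ~-refl {c}
                ; sym   = λ {c} {d} → ~-sym {c} {d}
                ; trans = λ {b} {c} {d} → ~-trans {b} {c} {d}
                }
              ; ∙-cong = λ {c} {d} {c′} {d′} → ⊕-cong {c} {d} {c′} {d′}
              }
            ; assoc = ⊕-assoc
            }
          ; identity = ⊕-identityˡ , λ c →
              ~-trans {c ⊕ 0ᶜ} {0ᶜ ⊕ c} {c} (⊕-comm c 0ᶜ) (⊕-identityˡ c)
          }
        ; inverse = ⊕-inverseˡ , λ c →
            ~-trans {c ⊕ (⊖ c)} {(⊖ c) ⊕ c} {0ᶜ} (⊕-comm c (⊖ c)) (⊕-inverseˡ c)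
        ; ⁻¹-cong = λ {c} {d} → ⊖-cong {c} {d}
        }
      ; comm = ⊕-comm
      }
    }

-- Existence of the rank: up to torsion, the subquotient of the free abelian group on Y
-- cut out by the functionals fs, modulo the span of bs, has coordinates in some ℤʳ.

private

  ≢0-* : ∀ {a b} → a ≢ 0ℤ → b ≢ 0ℤ → a * b ≢ 0ℤ
  ≢0-* {a} a≢0 b≢0 eq with ℤ.i*j≡0⇒i≡0∨j≡0 a eq
  ... | inj₁ a≡0 = a≢0 a≡0
  ... | inj₂ b≡0 = b≢0 b≡0

  cancel-≢0 : ∀ {a b} → a ≢ 0ℤ → a * b ≡ 0ℤ → b ≡ 0ℤ
  cancel-≢0 {a} a≢0 eq with ℤ.i*j≡0⇒i≡0∨j≡0 a eq
  ... | inj₁ a≡0 = contradiction a≡0 a≢0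
  ... | inj₂ b≡0 = b≡0

  zero-or-pivot : ∀ {n} (t : Fin n → ℤ) → (∀ i → t i ≡ 0ℤ) ⊎ (∃ λ i → t i ≢ 0ℤ)
  zero-or-pivot t with Fin.any? (λ i → ¬? (t i ℤ.≟ 0ℤ))
  ... | yes pivot = inj₂ pivot
  ... | no none = inj₁ λ i → decidable-stable (t i ℤ.≟ 0ℤ) λ ti≢0 → none (i , ti≢0)

  on-punchIn : ∀ {n} (P : Fin (suc n) → Set) j → P j → (∀ i → P (punchIn j i)) → ∀ i → P i
  on-punchIn P j pj h i with j Fin.≟ i
  ... | yes refl = pj
  ... | no j≢i = subst P (Fin.punchIn-punchOut j≢i) (h (punchOut j≢i))

  open ℤSum using (sum; sum-cong-≗; ∑-distrib-+; *-distribˡ-sum)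

  sum-0 : ∀ {n} {t : Fin n → ℤ} → (∀ i → t i ≡ 0ℤ) → sum t ≡ 0ℤ
  sum-0 {zero} h = refl
  sum-0 {suc n} h = cong₂ _+_ (h zero) (sum-0 (h ∘ suc))

  sum-single : ∀ {n} (t : Fin n → ℤ) j → (∀ i → i ≢ j → t i ≡ 0ℤ) → sum t ≡ t j
  sum-single t zero h =
    trans (cong (λ s → t zero + s) (sum-0 λ i → h (suc i) λ ())) (ℤ.+-identityʳ _)
  sum-single t (suc j) h = trans
    (cong₂ _+_ (h zero λ ()) (sum-single (t ∘ suc) j λ i i≢j → h (suc i) (i≢j ∘ Fin.suc-injective)))
    (ℤ.+-identityˡ _)

  dependence : ∀ {r s} → r ℕ.< s → (m : Fin r → Fin s → ℤ) → ∃ λ (c : Fin s → ℤ) →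
    (∃ λ j → c j ≢ 0ℤ) × (∀ i → sum (λ j → c j * m i j) ≡ 0ℤ)
  dependence {zero} {suc s} _ m = (λ _ → 1ℤ) , (zero , λ ()) , λ ()
  dependence {suc r} {suc s} (ℕ.s≤s r<s) m with zero-or-pivot (λ i → m i zero)
  ... | inj₁ col≡0 = c , (zero , λ ()) , λ i →
          cong₂ _+_ (cong (1ℤ *_) (col≡0 i)) (sum-0 {t = λ j → c (suc j) * m i (suc j)} λ _ → refl)
    where
      c : Fin (suc s) → ℤ
      c zero    = 1ℤ
      c (suc _) = 0ℤ
  ... | inj₂ (p , a≢0) with dependence r<s (λ i j →
          m p zero * m (punchIn p i) (suc j) + - m (punchIn p i) zero * m p (suc j))
  ... | c′ , (j , c′j≢0) , h = c , (suc j , ≢0-* a≢0 c′j≢0) ,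
          on-punchIn (λ i → sum (λ j → c j * m i j) ≡ 0ℤ) p pivot-row other-row
    where
      a = m p zero
      c : Fin (suc s) → ℤ
      c zero    = - sum (λ j → c′ j * m p (suc j))
      c (suc j) = a * c′ j

      expand : ∀ i → sum (λ j → a * c′ j * m i (suc j)) ≡ a * sum (λ j → c′ j * m i (suc j))
      expand i = trans (sum-cong-≗ (λ j → ℤ.*-assoc a (c′ j) (m i (suc j))))
                       (sym (*-distribˡ-sum a (λ j → c′ j * m i (suc j))))

      pivot-row : sum (λ j → c j * m p j) ≡ 0ℤ
      pivot-row = trans (cong (λ t → c zero * a + t) (expand p))
                        (lemma a (sum (λ j → c′ j * m p (suc j))))
        where
          lemma : ∀ a s → - s * a + a * s ≡ 0ℤ
          lemma = solve-∀

      other-row : ∀ i → sum (λ j → c j * m (punchIn p i) j) ≡ 0ℤ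
      other-row i = trans (cong (λ t → c zero * b + t) (expand (punchIn p i)))
        (trans (lemma₁ a b (sum (λ j → c′ j * m p (suc j))) (sum (λ j → c′ j * m (punchIn p i) (suc j))))
        (trans (cong₂ _+_ (*-distribˡ-sum a (λ j → c′ j * m (punchIn p i) (suc j)))
                          (*-distribˡ-sum (- b) (λ j → c′ j * m p (suc j))))
        (trans (sym (∑-distrib-+ (λ j → a * (c′ j * m (punchIn p i) (suc j)))
                                 (λ j → - b * (c′ j * m p (suc j)))))
        (trans (sum-cong-≗ (λ j → lemma₂ a b (c′ j) (m (punchIn p i) (suc j)) (m p (suc j)))) (h i)))))
        where
          b = m (punchIn p i) zero
          lemma₁ : ∀ a b s t → - s * b + a * t ≡ a * t + - b * s
          lemma₁ = solve-∀
          lemma₂ : ∀ a b c x y → a * (c * x) + - b * (c * y) ≡ c * (a * x + - b * y)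
          lemma₂ = solve-∀

  lookup-injective : ∀ {xs : List X} → Unique xs →
    ∀ i j → List.lookup xs i ≡ List.lookup xs j → i ≡ j
  lookup-injective (_ ∷ _) zero zero _ = refl
  lookup-injective (x∉ ∷ _) zero (suc j) eq = contradiction eq (All.lookup x∉ (∈-lookup j))
  lookup-injective (x∉ ∷ _) (suc i) zero eq = contradiction (sym eq) (All.lookup x∉ (∈-lookup i))
  lookup-injective (_ ∷ u) (suc i) (suc j) eq = cong suc (lookup-injective u i j eq)

  index : ∀ {x : X} {xs} → x ∈ xs → ∃ λ i → List.lookup xs i ≡ x
  index (here refl) = zero , refl
  index (there x∈) with index x∈
  ... | i , eq = suc i , eq

  Annihilated : List (Y → ℤ) → Formal Y → Set
  Annihilated fs c = All (λ φ → eval φ c ≡ 0ℤ) fs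

  InSpan : List (Formal Y) → Formal Y → Set
  InSpan []       c = ∀ φ → eval φ c ≡ 0ℤ
  InSpan (b ∷ bs) c = ∃ λ m → InSpan bs (c ++ scale m b)

  eval-++-scale : ∀ (φ : Y → ℤ) c m b → eval φ (c ++ scale m b) ≡ eval φ c + m * eval φ b
  eval-++-scale φ c m b = trans (eval-++ φ c _) (cong (λ t → eval φ c + t) (eval-scale φ m b))

  InSpan-resp : ∀ (bs : List (Formal Y)) {c d} → (∀ φ → eval φ c ≡ eval φ d) → InSpan bs c → InSpan bs d
  InSpan-resp [] h c∈ φ = trans (sym (h φ)) (c∈ φ)
  InSpan-resp (b ∷ bs) {c} {d} h (m , c∈) = m , InSpan-resp bs (λ φ →
    trans (eval-++-scale φ c m b)
    (trans (cong (λ t → t + m * eval φ b) (h φ)) (sym (eval-++-scale φ d m b)))) c∈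

  Annihilated-combine : ∀ {fs : List (Y → ℤ)} p q c d → Annihilated fs c → Annihilated fs d →
    Annihilated fs (scale p c ++ scale q d)
  Annihilated-combine p q c d hc hd = All.zipWith
    (λ {φ} (eq , eq′) → trans (eval-++-scale φ (scale p c) q d)
      (trans (cong₂ _+_ (trans (eval-scale φ p c) (cong (p *_) eq)) (cong (q *_) eq′)) (lemma p q)))
    (hc , hd)
    where
      lemma : ∀ p q → p * 0ℤ + q * 0ℤ ≡ 0ℤ
      lemma = solve-∀

  record Frame (fs : List (Y → ℤ)) (bs : List (Formal Y)) (r : ℕ) : Set where
    field
      basis    : Fin r → Formal Y
      dual     : Fin r → Y → ℤ
      d        : ℤ
      d≢0      : d ≢ 0ℤ
      basis-∈  : ∀ i → Annihilated fs (basis i)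
      diagonal : ∀ i → eval (dual i) (basis i) ≡ d
      off      : ∀ i j → i ≢ j → eval (dual i) (basis j) ≡ 0ℤ
      dual-0   : ∀ i → All (λ b → eval (dual i) b ≡ 0ℤ) bs
      torsion  : ∀ c → Annihilated fs c → (∀ i → eval (dual i) c ≡ 0ℤ) →
                 ∃ λ n → n ≢ 0ℤ × InSpan bs (scale n c)

  frame-free : (finite : IsFinite Y) → Frame {Y} [] [] (List.length (IsFinite.elements finite))
  frame-free finite = record
    { basis    = λ i → (1ℤ , List.lookup elements i) ∷ []
    ; dual     = λ i → δ (List.lookup elements i)
    ; d        = 1ℤ
    ; d≢0      = λ ()
    ; basis-∈  = λ _ → []
    ; diagonal = λ i → cong (λ t → 1ℤ * t + 0ℤ) (δ-diag (List.lookup elements i))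
    ; off      = λ i j i≢j → cong (λ t → 1ℤ * t + 0ℤ) (δ-off (i≢j ∘ lookup-injective unique i j))
    ; dual-0   = λ _ → []
    ; torsion  = λ c _ h → 1ℤ , (λ ()) , λ φ → trans (eval-scale φ 1ℤ c)
        (cong (1ℤ *_) (eval-≈ φ {c} {[]} (λ y → let i , eq = index (complete y) in
          trans (cong (λ y → eval (δ y) c) (sym eq)) (h i))))
    }
    where open IsFinite finite

  frame-kernel : ∀ {fs : List (Y → ℤ)} {r} f → Frame fs [] r → ∃ (Frame (f ∷ fs) [])
  frame-kernel {r = r} f F with zero-or-pivot (λ j → eval f (Frame.basis F j))
  ... | inj₁ f≡0 = r , record
    { Frame F
    ; basis-∈ = λ i → f≡0 i ∷ Frame.basis-∈ F i
    ; torsion = λ { c (_ ∷ c∈) h → Frame.torsion F c c∈ h }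
    }
  frame-kernel {r = suc r} f F | inj₂ (j , p≢0) = r , record
    { basis    = λ i → scale p (basis (punchIn j i)) ++ scale (- eval f (basis (punchIn j i))) (basis j)
    ; dual     = λ i → dual (punchIn j i)
    ; d        = p * d
    ; d≢0      = ≢0-* p≢0 d≢0
    ; basis-∈  = λ i →
        trans (combo f (punchIn j i)) (lemma₁ p (eval f (basis (punchIn j i)))) ∷
        Annihilated-combine p (- eval f (basis (punchIn j i))) (basis (punchIn j i)) (basis j)
          (basis-∈ (punchIn j i)) (basis-∈ j)
    ; diagonal = λ i → trans (combo (dual (punchIn j i)) (punchIn j i))
        (trans (cong₂ (λ a b → p * a + - eval f (basis (punchIn j i)) * b)
                      (diagonal (punchIn j i)) (off (punchIn j i) j (Fin.punchInᵢ≢i j i)))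
               (lemma₂ (p * d) (- eval f (basis (punchIn j i)))))
    ; off      = λ i k i≢k → trans (combo (dual (punchIn j i)) (punchIn j k))
        (trans (cong₂ (λ a b → p * a + - eval f (basis (punchIn j k)) * b)
                      (off (punchIn j i) (punchIn j k) (i≢k ∘ Fin.punchIn-injective j i k))
                      (off (punchIn j i) j (Fin.punchInᵢ≢i j i)))
               (lemma₃ p (- eval f (basis (punchIn j k)))))
    ; dual-0   = λ _ → []
    ; torsion  = torsion′
    }
    where
      open Frame F
      p = eval f (basis j)

      combo : ∀ φ i → eval φ (scale p (basis i) ++ scale (- eval f (basis i)) (basis j))
                    ≡ p * eval φ (basis i) + - eval f (basis i) * eval φ (basis j)
      combo φ i = trans (eval-++-scale φ (scale p (basis i)) (- eval f (basis i)) (basis j))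
        (cong (λ t → t + - eval f (basis i) * eval φ (basis j)) (eval-scale φ p (basis i)))

      lemma₁ : ∀ p q → p * q + - q * p ≡ 0ℤ
      lemma₁ = solve-∀
      lemma₂ : ∀ a b → a + b * 0ℤ ≡ a
      lemma₂ = solve-∀
      lemma₃ : ∀ a b → a * 0ℤ + b * 0ℤ ≡ 0ℤ
      lemma₃ = solve-∀
      lemma₄ : ∀ a b → a * b + - b * a ≡ 0ℤ
      lemma₄ = solve-∀
      lemma₅ : ∀ n d s p → n * (d * 0ℤ + - s * p) ≡ - (n * p) * s
      lemma₅ = solve-∀

      torsion′ : ∀ c → Annihilated _ c → (∀ i → eval (dual (punchIn j i)) c ≡ 0ℤ) →
                 ∃ λ n → n ≢ 0ℤ × InSpan [] (scale n c)
      torsion′ c (fc≡0 ∷ c∈) h = torsion c c∈ (on-punchIn (λ i → eval (dual i) c ≡ 0ℤ) j s≡0 h)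
        where
          s = eval (dual j) c
          c′ = scale d c ++ scale (- s) (basis j)
          combo′ : ∀ φ → eval φ c′ ≡ d * eval φ c + - s * eval φ (basis j)
          combo′ φ = trans (eval-++-scale φ (scale d c) (- s) (basis j))
            (cong (λ t → t + - s * eval φ (basis j)) (eval-scale φ d c))
          torsion-c′ : ∃ λ n → n ≢ 0ℤ × (∀ φ → eval φ (scale n c′) ≡ 0ℤ)
          torsion-c′ = torsion c′ (Annihilated-combine d (- s) c (basis j) c∈ (basis-∈ j))
            (on-punchIn (λ i → eval (dual i) c′ ≡ 0ℤ) j
              (trans (combo′ (dual j)) (trans (cong (λ t → d * s + - s * t) (diagonal j)) (lemma₄ d s)))
              (λ i → trans (combo′ _) (trans (cong₂ (λ a b → d * a + - s * b) (h i)
                (off (punchIn j i) j (Fin.punchInᵢ≢i j i))) (lemma₃ d (- s)))))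
          s≡0 : s ≡ 0ℤ
          s≡0 with torsion-c′
          ... | n , n≢0 , nc′≡0 = cancel-≢0 {n * p} (≢0-* n≢0 p≢0)
            (trans (sym (ℤ.neg-involutive _))
            (cong -_ (trans (ℤ.neg-distribˡ-* (n * p) s)
            (trans (sym (lemma₅ n d s p))
            (trans (cong (λ t → n * (d * t + - s * p)) (sym fc≡0))
            (trans (cong (n *_) (sym (combo′ f)))
            (trans (sym (eval-scale f n c′)) (nc′≡0 f))))))))

  frame-quotient : ∀ {fs : List (Y → ℤ)} {bs r} b → Annihilated fs b → Frame fs bs r →
    ∃ (Frame fs (b ∷ bs))
  frame-quotient {bs = bs} {r = r} b b∈ F with zero-or-pivot (λ j → eval (Frame.dual F j) b)
  ... | inj₁ b≡0 = r , record
    { Frame F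
    ; dual-0  = λ i → b≡0 i ∷ Frame.dual-0 F i
    ; torsion = λ c c∈ h → let n , n≢0 , nc∈ = Frame.torsion F c c∈ h in
        n , n≢0 , 0ℤ , InSpan-resp bs
          (λ φ → sym (trans (eval-++-scale φ (scale n c) 0ℤ b) (lemma (eval φ (scale n c)) (eval φ b)))) nc∈
    }
    where
      lemma : ∀ a b → a + 0ℤ * b ≡ a
      lemma = solve-∀
  frame-quotient {bs = bs} {r = suc r} b b∈ F | inj₂ (j , p≢0) = r , record
    { basis    = λ i → basis (punchIn j i)
    ; dual     = dual′
    ; d        = p * d
    ; d≢0      = ≢0-* p≢0 d≢0
    ; basis-∈  = λ i → basis-∈ (punchIn j i)
    ; diagonal = λ i → trans (eval-dual′ i (basis (punchIn j i)))
        (trans (cong₂ (λ s t → p * s + - q i * t) (diagonal (punchIn j i))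
                      (off j (punchIn j i) (Fin.punchInᵢ≢i j i ∘ sym)))
               (lemma₂ (p * d) (- q i)))
    ; off      = λ i k i≢k → trans (eval-dual′ i (basis (punchIn j k)))
        (trans (cong₂ (λ s t → p * s + - q i * t)
                      (off (punchIn j i) (punchIn j k) (i≢k ∘ Fin.punchIn-injective j i k))
                      (off j (punchIn j k) (Fin.punchInᵢ≢i j k ∘ sym)))
               (lemma₃ p (- q i)))
    ; dual-0   = λ i →
        trans (eval-dual′ i b) (lemma₁ p (q i)) ∷
        All.zipWith (λ {b′} (h , h′) → trans (eval-dual′ i b′)
          (trans (cong₂ (λ s t → p * s + - q i * t) h h′) (lemma₃ p (- q i))))
          (dual-0 (punchIn j i) , dual-0 j)
    ; torsion  = torsion′
    }
    where
      open Frame F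
      p = eval (dual j) b
      q : Fin r → ℤ
      q i = eval (dual (punchIn j i)) b

      dual′ : Fin r → _ → ℤ
      dual′ i y = p * dual (punchIn j i) y + - q i * dual j y

      eval-dual′ : ∀ i c → eval (dual′ i) c ≡ p * eval (dual (punchIn j i)) c + - q i * eval (dual j) c
      eval-dual′ i c = eval-combine p (- q i) (dual (punchIn j i)) (dual j) c

      lemma₁ : ∀ p q → p * q + - q * p ≡ 0ℤ
      lemma₁ = solve-∀
      lemma₂ : ∀ a b → a + b * 0ℤ ≡ a
      lemma₂ = solve-∀
      lemma₃ : ∀ a b → a * 0ℤ + b * 0ℤ ≡ 0ℤ
      lemma₃ = solve-∀
      lemma₄ : ∀ p s u q → p * u + - s * q ≡ p * u + - q * s
      lemma₄ = solve-∀
      lemma₅ : ∀ n p s u v → n * (p * u + - s * v) ≡ n * p * u + - (n * s) * v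
      lemma₅ = solve-∀

      torsion′ : ∀ c → Annihilated _ c → (∀ i → eval (dual′ i) c ≡ 0ℤ) →
                 ∃ λ n → n ≢ 0ℤ × InSpan (b ∷ bs) (scale n c)
      torsion′ c c∈ h with torsion c′ (Annihilated-combine p (- s) c b c∈ b∈)
          (on-punchIn (λ i → eval (dual i) c′ ≡ 0ℤ) j
            (trans (combo (dual j)) (lemma₁ p s))
            (λ i → trans (combo (dual (punchIn j i)))
              (trans (lemma₄ p s (eval (dual (punchIn j i)) c) (q i)) (trans (sym (eval-dual′ i c)) (h i)))))
        where
          s = eval (dual j) c
          c′ = scale p c ++ scale (- s) b
          combo : ∀ φ → eval φ c′ ≡ p * eval φ c + - s * eval φ b
          combo φ = trans (eval-++-scale φ (scale p c) (- s) b)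
            (cong (λ t → t + - s * eval φ b) (eval-scale φ p c))
      ... | n , n≢0 , nc′∈ = n * p , ≢0-* n≢0 p≢0 , - (n * s) , InSpan-resp bs
          (λ φ → trans (eval-scale φ n (scale p c ++ scale (- s) b))
            (trans (cong (n *_) (trans (eval-++-scale φ (scale p c) (- s) b)
                                       (cong (λ t → t + - s * eval φ b) (eval-scale φ p c))))
            (trans (lemma₅ n p s (eval φ c) (eval φ b))
            (sym (trans (eval-++-scale φ (scale (n * p) c) (- (n * s)) b)
                        (cong (λ t → t + - (n * s) * eval φ b) (eval-scale φ (n * p) c))))))) nc′∈
        where
          s = eval (dual j) c

  frame : IsFinite Y → ∀ fs bs → All (Annihilated {Y} fs) bs → ∃ (Frame fs bs)
  frame finite [] [] [] = _ , frame-free finite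
  frame finite (f ∷ fs) [] [] = frame-kernel f (proj₂ (frame finite fs [] []))
  frame finite fs (b ∷ bs) (b∈ ∷ bs∈) = frame-quotient b b∈ (proj₂ (frame finite fs bs bs∈))

module _ {X Y Z : Set} (f : X → Formal Y) (g : Y → Formal Z)
         (finiteX : IsFinite X) (finiteY : IsFinite Y) (finiteZ : IsFinite Z) where
  open Homology f g finiteX finiteY finiteZ
  open Rank homologyGroup

  private
    module X = IsFinite finiteX
    module Y = IsFinite finiteY
    module Z = IsFinite finiteZ
    open RawMonoidDefs (AbelianGroup.rawMonoid homologyGroup) using () renaming (_×_ to _×ᴺ_; sum to sumᴴ)

    eval-×ᴺ : ∀ φ n c → eval φ (proj₁ (n ×ᴺ c)) ≡ + n * eval φ (proj₁ c)
    eval-×ᴺ φ zero c = sym (ℤ.*-zeroˡ (eval φ (proj₁ c)))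
    eval-×ᴺ φ (suc n) c = trans (eval-++ φ (proj₁ c) _)
      (trans (cong (λ t → eval φ (proj₁ c) + t) (eval-×ᴺ φ n c)) (sym (ℤ.suc-* (+ n) _)))

    eval-· : ∀ φ n c → eval φ (proj₁ (n · c)) ≡ n * eval φ (proj₁ c)
    eval-· φ (+ n) c = eval-×ᴺ φ n c
    eval-· φ -[1+ n ] c = trans (eval-scale φ -1ℤ (proj₁ (suc n ×ᴺ c)))
      (trans (cong (-1ℤ *_) (eval-×ᴺ φ (suc n) c))
      (trans (ℤ.-1*i≡-i _) (ℤ.neg-distribˡ-* (+ suc n) _)))

    eval-sum : ∀ φ {r} (v : Fin r → Cycle) → eval φ (proj₁ (sumᴴ v)) ≡ sum (λ j → eval φ (proj₁ (v j)))
    eval-sum φ {zero} v = refl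
    eval-sum φ {suc r} v = trans (eval-++ φ (proj₁ (v zero)) _)
      (cong (λ t → eval φ (proj₁ (v zero)) + t) (eval-sum φ (v ∘ suc)))

    eval-combination : ∀ φ {r} (c : Fin r → ℤ) (v : Fin r → Cycle) →
      eval φ (proj₁ (sumᴴ λ j → c j · v j)) ≡ sum (λ j → c j * eval φ (proj₁ (v j)))
    eval-combination φ c v = trans (eval-sum φ (λ j → c j · v j)) (sum-cong-≗ λ j → eval-· φ (c j) (v j))

    equations : List (Y → ℤ)
    equations = List.map (λ z y → Z.coeff z (g y)) Z.elements

    equations⇒cycle : ∀ {c} → Annihilated equations c → IsCycle c
    equations⇒cycle {c} h z = trans (eval-extend (Z.δ z) g c)
      (All.lookup (AllP.map⁻ h) (Z.complete z))

    cycle⇒equations : ∀ {c} → IsCycle c → Annihilated equations c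
    cycle⇒equations {c} h = AllP.map⁺ (All.tabulate λ {z} _ →
      trans (sym (eval-extend (Z.δ z) g c)) (h z))

    span⇒boundary : ∀ xs c → InSpan (List.map f xs) c → ∃ λ w →
      ∀ φ → eval φ c ≡ eval (λ x → eval φ (f x)) w
    span⇒boundary [] c c∈ = [] , c∈
    span⇒boundary (x ∷ xs) c (m , c∈) with span⇒boundary xs (c ++ scale m (f x)) c∈
    ... | w , h = (- m , x) ∷ w , λ φ → trans (lemma (eval φ c) m (eval φ (f x)))
          (cong (λ t → - m * eval φ (f x) + t) (trans (sym (eval-++-scale φ c m (f x))) (h φ)))
      where
        lemma : ∀ a m b → a ≡ - m * b + (a + m * b)
        lemma = solve-∀

    ~0⁻¹ : ∀ {c} → c ~ AbelianGroup.ε homologyGroup → ∀ φ → (∀ x → eval φ (f x) ≡ 0ℤ) →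
      eval φ (proj₁ c) ≡ 0ℤ
    ~0⁻¹ {c , _} (w , h) φ φf≡0 =
      trans (cong (eval φ) (sym (List.++-identityʳ c)))
      (trans (Y.eval-≈ φ {c ++ []} {extend f w} h)
      (trans (eval-extend φ f w) (eval-0 φf≡0 w)))

    ~0 : ∀ {c} w → (∀ φ → eval φ (proj₁ c) ≡ eval (λ x → eval φ (f x)) w) →
      c ~ AbelianGroup.ε homologyGroup
    ~0 {c , _} w h = w , λ y → trans (cong (eval (Y.δ y)) (List.++-identityʳ c))
      (trans (h (Y.δ y)) (sym (eval-extend (Y.δ y) f w)))

  abstract
    rank-exists : (∀ x → IsCycle (f x)) → ∃ IsRank
    rank-exists gf≡0 = r , (v , v-independent) , maximal
      where
        F : ∃ (Frame equations (List.map f X.elements))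
        F = frame finiteY equations (List.map f X.elements)
              (AllP.map⁺ (All.tabulate λ {x} _ → cycle⇒equations {f x} (gf≡0 x)))
        r : ℕ
        r = proj₁ F
        open Frame (proj₂ F)

        dual-f : ∀ i x → eval (dual i) (f x) ≡ 0ℤ
        dual-f i x = All.lookup (AllP.map⁻ (dual-0 i)) (X.complete x)

        v : Fin r → Cycle
        v i = basis i , equations⇒cycle {basis i} (basis-∈ i)

        v-independent : LinearlyIndependent v
        v-independent c h i = cancel-≢0 {d} d≢0 (trans (ℤ.*-comm d (c i))
          (trans (cong (c i *_) (sym (diagonal i)))
          (trans (sym (sum-single (λ j → c j * eval (dual i) (basis j)) i λ j j≢i →
                   trans (cong (c j *_) (off i j (j≢i ∘ sym))) (ℤ.*-zeroʳ (c j))))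
          (trans (sym (eval-combination (dual i) c v))
          (~0⁻¹ {sumᴴ λ j → c j · v j} h (dual i) (dual-f i))))))

        too-many : ∀ {s} → r ℕ.< s → (w : Fin s → Cycle) → ¬ LinearlyIndependent w
        too-many r<s w w-ind with dependence r<s (λ i j → eval (dual i) (proj₁ (w j)))
        ... | c , (j , cj≢0) , h
          with torsion (proj₁ (sumᴴ λ j → c j · w j))
                 (cycle⇒equations {proj₁ (sumᴴ λ j → c j · w j)} (proj₂ (sumᴴ λ j → c j · w j)))
                 (λ i → trans (eval-combination (dual i) c w) (h i))
        ... | n , n≢0 , nx∈
          with span⇒boundary X.elements (scale n (proj₁ (sumᴴ λ j → c j · w j))) nx∈
        ... | u , hu = ≢0-* n≢0 cj≢0 (w-ind (λ j → n * c j)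
          (~0 {sumᴴ λ j → (n * c j) · w j} u λ φ →
            trans (eval-combination φ (λ j → n * c j) w)
            (trans (sum-cong-≗ λ j → ℤ.*-assoc n (c j) (eval φ (proj₁ (w j))))
            (trans (sym (*-distribˡ-sum n (λ j → c j * eval φ (proj₁ (w j)))))
            (trans (cong (n *_) (sym (eval-combination φ c w)))
            (trans (sym (eval-scale φ n (proj₁ (sumᴴ λ j → c j · w j)))) (hu φ)))))) j)

        maximal : ∀ s (w : Fin s → Cycle) → LinearlyIndependent w → s ℕ.≤ r
        maximal s w w-ind = ℕ.≮⇒≥ λ r<s → too-many r<s w w-ind

-- The augmented simplicial chain complex of the order complex of Q. A chain of k
-- elements is a simplex of dimension k - 1; k = 0 is the empty simplex.

module OrderComplex (Q : FinitePoset) where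
  open FinitePoset Q

  Increasing : ∀ {k} → Vec Carrier k → Set
  Increasing = VecAllPairs.AllPairs _<_

  Chain : ℕ → Set
  Chain k = Refinement (Vec Carrier k) Increasing

  private
    vectors : ∀ k → List (Vec Carrier k)
    vectors zero    = [] ∷ []
    vectors (suc k) = List.cartesianProductWith _∷_ elements (vectors k)

    vectors-unique : ∀ k → Unique (vectors k)
    vectors-unique zero    = [] ∷ []
    vectors-unique (suc k) =
      Unique.cartesianProductWith⁺ _∷_ Vec.∷-injective unique (vectors-unique k)

    vectors-complete : ∀ {k} (v : Vec Carrier k) → v ∈ vectors k
    vectors-complete []      = here refl
    vectors-complete (x ∷ v) = ∈-cartesianProductWith⁺ _∷_ (complete x) (vectors-complete v)

    vec-isFinite : ∀ k → IsFinite (Vec Carrier k)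
    vec-isFinite k = record
      { _≟_      = Vec.≡-dec _≟_
      ; elements = vectors k
      ; unique   = vectors-unique k
      ; complete = vectors-complete
      }

  chain-isFinite : ∀ k → IsFinite (Chain k)
  chain-isFinite k = refinement-isFinite (vec-isFinite k) (VecAllPairs.allPairs? _<?_)

  private
    removeAt-All : ∀ {k} {P : Carrier → Set} {v : Vec Carrier (suc k)} →
      VecAll.All P v → ∀ j → VecAll.All P (removeAt v j)
    removeAt-All (_ ∷ h) zero = h
    removeAt-All (p ∷ h@(_ ∷ _)) (suc j) = p ∷ removeAt-All h j

    removeAt-Increasing : ∀ {k} {v : Vec Carrier (suc k)} →
      Increasing v → ∀ j → Increasing (removeAt v j)
    removeAt-Increasing (_ ∷ h) zero = h
    removeAt-Increasing (p ∷ h@(_ ∷ _)) (suc j) = removeAt-All p j ∷ removeAt-Increasing h j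

  face : ∀ {k} → Chain (suc k) → Fin (suc k) → Chain k
  face (v , [ h ]) j = removeAt v j , [ removeAt-Increasing h j ]

  boundary : ∀ k → Chain k → Formal (Chain (ℕ.pred k))
  boundary zero    _ = []
  boundary (suc k) σ = List.tabulate λ j → -1ℤ ℤ.^ toℕ j , face σ j

  module H̃ (k : ℕ) = Homology (boundary (suc k)) (boundary k)
    (chain-isFinite (suc k)) (chain-isFinite k) (chain-isFinite (ℕ.pred k))

  private
    open ℤSum using (sum; sum-cong-≗; ∑-distrib-+; *-distribˡ-sum)

    eval-tabulate : ∀ {X : Set} (φ : X → ℤ) {n} (s : Fin n → ℤ) (t : Fin n → X) →
      eval φ (List.tabulate λ j → s j , t j) ≡ sum (λ j → s j * φ (t j))
    eval-tabulate φ {zero}  s t = refl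
    eval-tabulate φ {suc n} s t =
      cong (λ a → s zero * φ (t zero) + a) (eval-tabulate φ (s ∘ suc) (t ∘ suc))

    D : ∀ {k} → (Vec Carrier k → ℤ) → Vec Carrier (suc k) → ℤ
    D ψ v = sum (λ j → -1ℤ ℤ.^ toℕ j * ψ (removeAt v j))

    D-cong : ∀ {k} {ψ χ : Vec Carrier k → ℤ} → ψ ≗ χ → D ψ ≗ D χ
    D-cong h v = sum-cong-≗ λ j → cong (-1ℤ ℤ.^ toℕ j *_) (h (removeAt v j))

    D-combine : ∀ {k} (ψ χ : Vec Carrier k → ℤ) v → D (λ u → ψ u + -1ℤ * χ u) v ≡ D ψ v + -1ℤ * D χ v
    D-combine ψ χ v =
      trans (sum-cong-≗ λ j → lemma (-1ℤ ℤ.^ toℕ j) (ψ (removeAt v j)) (χ (removeAt v j)))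
      (trans (∑-distrib-+ (λ j → -1ℤ ℤ.^ toℕ j * ψ (removeAt v j))
                          (λ j → -1ℤ * (-1ℤ ℤ.^ toℕ j * χ (removeAt v j))))
      (cong (λ t → D ψ v + t) (sym (*-distribˡ-sum -1ℤ (λ j → -1ℤ ℤ.^ toℕ j * χ (removeAt v j))))))
      where
        lemma : ∀ s a b → s * (a + -1ℤ * b) ≡ s * a + -1ℤ * (s * b)
        lemma = solve-∀

    D-∷ : ∀ {k} (ψ : Vec Carrier (suc k) → ℤ) x v → D ψ (x ∷ v) ≡ ψ v + -1ℤ * D (ψ ∘ (x ∷_)) v
    D-∷ ψ x v@(_ ∷ _) = cong₂ _+_ (ℤ.*-identityˡ (ψ v))
      (trans (sum-cong-≗ λ j → ℤ.*-assoc -1ℤ (-1ℤ ℤ.^ toℕ j) (ψ (x ∷ removeAt v j)))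
             (sym (*-distribˡ-sum -1ℤ (λ j → -1ℤ ℤ.^ toℕ j * ψ (x ∷ removeAt v j)))))

    DD≡0 : ∀ {k} (ψ : Vec Carrier k → ℤ) v → D (D ψ) v ≡ 0ℤ
    DD≡0 {zero} ψ (x ∷ y ∷ []) = lemma (ψ [])
      where
        lemma : ∀ a → 1ℤ * (1ℤ * a + 0ℤ) + (-1ℤ * (1ℤ * a + 0ℤ) + 0ℤ) ≡ 0ℤ
        lemma = solve-∀
    DD≡0 {suc k} ψ (x ∷ v) =
      trans (D-∷ (D ψ) x v)
      (trans (cong (λ t → D ψ v + -1ℤ * t)
        (trans (D-cong (D-∷ ψ x) v)
        (trans (D-combine ψ (D (ψ ∘ (x ∷_))) v)
               (cong (λ t → D ψ v + -1ℤ * t) (DD≡0 (ψ ∘ (x ∷_)) v)))))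
      (lemma (D ψ v)))
      where
        lemma : ∀ a → a + -1ℤ * (a + -1ℤ * 0ℤ) ≡ 0ℤ
        lemma = solve-∀

    δ-value : ∀ {k} (τ ρ : Chain k) →
      IsFinite.δ (chain-isFinite k) τ ρ ≡ IsFinite.δ (vec-isFinite k) (value τ) (value ρ)
    δ-value {k} τ ρ with IsFinite._≟_ (chain-isFinite k) τ ρ
    ... | yes refl = sym (IsFinite.δ-diag (vec-isFinite k) (value τ))
    ... | no τ≢ρ   = sym (IsFinite.δ-off (vec-isFinite k) (τ≢ρ ∘ value-injective))

  boundary-isCycle : ∀ k (σ : Chain (suc k)) → H̃.IsCycle k (boundary (suc k) σ)
  boundary-isCycle zero σ τ = trans (eval-extend (IsFinite.δ (chain-isFinite 0) τ) (boundary 0) (boundary 1 σ))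
    (eval-0 (λ _ → refl) (boundary 1 σ))
  boundary-isCycle (suc k) σ τ =
    trans (eval-extend δτ (boundary (suc k)) (boundary (suc (suc k)) σ))
    (trans (eval-tabulate (λ ρ → eval δτ (boundary (suc k) ρ)) (λ j → -1ℤ ℤ.^ toℕ j) (face σ))
    (trans (sum-cong-≗ λ j → cong (-1ℤ ℤ.^ toℕ j *_)
      (trans (eval-tabulate δτ (λ j → -1ℤ ℤ.^ toℕ j) (face (face σ j)))
             (sum-cong-≗ λ i → cong (-1ℤ ℤ.^ toℕ i *_) (δ-value τ (face (face σ j) i)))))
    (DD≡0 (IsFinite.δ (vec-isFinite k) (value τ)) (value σ))))
    where δτ = IsFinite.δ (chain-isFinite k) τ

  hasRank : ∀ k → ∃ (Rank.IsRank (H̃.homologyGroup k))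
  hasRank k = rank-exists (boundary (suc k)) (boundary k)
    (chain-isFinite (suc k)) (chain-isFinite k) (chain-isFinite (ℕ.pred k)) (boundary-isCycle k)

-- Reduced Betti numbers; the simplices have dimension at least -1.

β : ℤ → BoundedPoset → ℕ
β (+ i)        P = proj₁ (OrderComplex.hasRank (BoundedPoset.properPart P) (suc i))
β -[1+ zero ]  P = proj₁ (OrderComplex.hasRank (BoundedPoset.properPart P) 0)
β -[1+ suc _ ] P = 0

{-# OPTIONS --safe #-}
-- In an interval order, a ≺ b forces every element above b to lie above a, so every element of
-- P̄ that is not an atom lies above a₀. Hence P̄ without the other atoms is a cone with apex a₀,
-- and each other atom b is attached to it along the order complex of the open interval (b , 1̂).
-- On chains: φ b deletes a leading b, ψ b τ = bτ - a₀τ, and h σ = a₀σ where this is a chain (and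
-- 0 elsewhere). Then φ b (ψ b τ) = τ, φ b (ψ b′ τ) = 0 for b ≢ b′, and ∂h + h∂ + Σ ψ b (φ b) is
-- the identity, so the maps φ b split the homology of P̄ into that of the intervals (b , 1̂), one
-- dimension lower. Ranks add up because rank (A/N) = rank (A/M) + rank ((A ∩ M)/N) for N ⊆ M.
module Submission where

open import Defs
open import Data.Integer using (ℤ; 0ℤ; 1ℤ; _≤_; _-_)
open import Data.List using (map)
open import Data.Nat using (ℕ)
open import Data.Nat.ListAction using (sum)
open import Relation.Binary.PropositionalEquality using (_≡_)

open import Algebra.Bundles using (AbelianGroup)
import Algebra.Definitions.RawMonoid as RawMonoidDefs
open import Data.Fin.Base using (toℕ; Fin; zero; suc; _↑ˡ_; _↑ʳ_)
open import Data.Integer using (_^_; ≢-nonZero; +_; -[1+_]; -1ℤ; _+_; _*_; -_)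
import Data.Integer.Properties as ℤ
open import Data.Irrelevant using ([_])
open import Data.Integer.Tactic.RingSolver using (solve-∀)
open import Data.List.Base as List using (List; []; _∷_; _++_)
import Data.List.Properties as List
open import Data.List.Membership.Propositional using (_∈_)
open import Data.List.Membership.Propositional.Properties using (∈-filter⁺)
open import Data.List.Relation.Unary.All as All using (All; []; _∷_)
import Data.List.Relation.Unary.All.Properties as AllP
open import Data.List.Relation.Unary.AllPairs as AllPairs using (AllPairs; []; _∷_)
import Data.List.Relation.Unary.AllPairs.Properties as AllPairsP
open import Data.List.Relation.Unary.Any as Any using (here; there)
open import Data.List.Relation.Unary.Unique.Propositional using (Unique)
import Data.List.Relation.Unary.Unique.Propositional.Properties as Unique
open import Data.Nat.Base as ℕ using (zero; suc)
import Data.Nat.Properties as ℕ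
open import Data.Product.Base using (∃; _×_; _,_; proj₁; proj₂)
import Data.Rational.Properties as ℚ
open import Data.Refinement using (Refinement; value; value-injective; _,_)
open import Data.Sum.Base using (_⊎_; inj₁; inj₂)
open import Data.Vec.Base as Vec using (Vec; []; _∷_; removeAt)
open import Data.Vec.Functional as Vector using (Vector)
import Data.Vec.Properties as Vec
import Data.Vec.Relation.Unary.All.Properties as VecAllP
import Data.Vec.Relation.Unary.AllPairs as VecAllPairs
open VecAllPairs using ([]; _∷_)
open import Data.Vec.Relation.Unary.All using ([]; _∷_)
open import Function.Base using (_∘_; id)
open import Function.Bundles using (Equivalence)
import Relation.Binary.Construct.NonStrictToStrict as ToStrict
open import Relation.Binary.Construct.Closure.ReflexiveTransitive using (ε; _◅_)
open import Relation.Binary.Definitions using (tri<; tri≈; tri>)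
open import Relation.Binary.PropositionalEquality
  using (_≢_; refl; sym; trans; cong; cong₂; subst; module ≡-Reasoning)
open import Relation.Nullary using (¬_; Dec; yes; no; contradiction)
open import Relation.Nullary.Decidable using (recompute; decidable-stable; _×-dec_; ¬?; ¬¬-excluded-middle)
import Relation.Unary as Unary
open Unary using (_∩_)

-- Membership in a subgroup of formal sums, such as the boundaries, is not decided here, so an
-- independent family cannot be split by an honest case distinction. The splitting is obtained only
-- up to double negation, which suffices because it serves an inequality between natural numbers.
-- Quotients are replaced by independence modulo a subgroup. The identities between φ, ψ, h and ∂
-- are proved for their transposes, acting on integer functionals of lists: there faces come from
-- plain recursion, and increase is assumed only where it is used. ψ b subtracts a₀τ so that the
-- face τ of bτ cancels; then ψ b, like φ b, anticommutes with ∂, and the sign is harmless for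
-- cycles and boundaries. The order of Dedekind reals is not decidable either, but each strict
-- inequality between endpoints yields a rational witness, and comparing two such rationals decides
-- which alternative of `interval-cross` holds.

private variable
  X Y Z : Set
  m n r s : ℕ

-- Formal sums and their subgroups

infix 4 _≐_
-- Testing with all functionals, not only coefficients, needs no decidable equality on `X` and lets
-- linear maps act by precomposition.
_≐_ : Formal X → Formal X → Set
c ≐ d = ∀ φ → eval φ c ≡ eval φ d

eval-scale-++ : ∀ (φ : X → ℤ) n c d → eval φ (scale n c ++ d) ≡ n * eval φ c + eval φ d
eval-scale-++ φ n c d = trans (eval-++ φ (scale n c) d) (cong (_+ eval φ d) (eval-scale φ n c))

eval-+ : ∀ (θ θ′ : X → ℤ) c → eval (λ x → θ x + θ′ x) c ≡ eval θ c + eval θ′ c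
eval-+ θ θ′ c = trans
  (eval-cong (λ x → sym (cong₂ _+_ (ℤ.*-identityˡ (θ x)) (ℤ.*-identityˡ (θ′ x)))) c)
  (trans (eval-combine 1ℤ 1ℤ θ θ′ c) (cong₂ _+_ (ℤ.*-identityˡ (eval θ c)) (ℤ.*-identityˡ (eval θ′ c))))

eval-neg : ∀ (θ : X → ℤ) c → eval (λ x → - θ x) c ≡ - eval θ c
eval-neg θ []            = refl
eval-neg θ ((n , x) ∷ c) = trans (cong (λ t → n * - θ x + t) (eval-neg θ c)) (lemma n (θ x) _)
  where
    lemma : ∀ n a b → n * - a + - b ≡ - (n * a + b)
    lemma = solve-∀

scale-0-++ : ∀ {n} → n ≡ 0ℤ → ∀ (c d : Formal X) → scale n c ++ d ≐ d
scale-0-++ refl c d φ = trans (eval-scale-++ φ 0ℤ c d) (ℤ.+-identityˡ _)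

record IsSubgroup (N : Formal X → Set) : Set where
  field
    resp    : ∀ {c d} → c ≐ d → N c → N d
    []∈     : N []
    ++∈     : ∀ {c d} → N c → N d → N (c ++ d)
    scale∈  : ∀ n {c} → N c → N (scale n c)

∩-isSubgroup : {M N : Formal X → Set} → IsSubgroup M → IsSubgroup N → IsSubgroup (M ∩ N)
∩-isSubgroup M N = record
  { resp   = λ eq (p , q) → M.resp eq p , N.resp eq q
  ; []∈    = M.[]∈ , N.[]∈
  ; ++∈    = λ (p , q) (p′ , q′) → M.++∈ p p′ , N.++∈ q q′
  ; scale∈ = λ n (p , q) → M.scale∈ n p , N.scale∈ n q
  }
  where
    module M = IsSubgroup M
    module N = IsSubgroup N

extend-++ : ∀ (f : X → Formal Y) c d → extend f (c ++ d) ≐ extend f c ++ extend f d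
extend-++ f c d φ = begin
  eval φ (extend f (c ++ d))                   ≡⟨ eval-extend φ f (c ++ d) ⟩
  eval (eval φ ∘ f) (c ++ d)                   ≡⟨ eval-++ _ c d ⟩
  eval (eval φ ∘ f) c + eval (eval φ ∘ f) d    ≡⟨ cong₂ _+_ (eval-extend φ f c) (eval-extend φ f d) ⟨
  eval φ (extend f c) + eval φ (extend f d)    ≡⟨ eval-++ φ (extend f c) _ ⟨
  eval φ (extend f c ++ extend f d)            ∎
  where open ≡-Reasoning

extend-scale : ∀ (f : X → Formal Y) n c → extend f (scale n c) ≐ scale n (extend f c)
extend-scale f n c φ = begin
  eval φ (extend f (scale n c))   ≡⟨ eval-extend φ f (scale n c) ⟩
  eval (eval φ ∘ f) (scale n c)   ≡⟨ eval-scale _ n c ⟩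
  n * eval (eval φ ∘ f) c         ≡⟨ cong (n *_) (eval-extend φ f c) ⟨
  n * eval φ (extend f c)         ≡⟨ eval-scale φ n (extend f c) ⟨
  eval φ (scale n (extend f c))   ∎
  where open ≡-Reasoning

extend-cong : ∀ (f : X → Formal Y) {c d} → c ≐ d → extend f c ≐ extend f d
extend-cong f {c} {d} eq φ =
  trans (eval-extend φ f c) (trans (eq (eval φ ∘ f)) (sym (eval-extend φ f d)))

preimage-isSubgroup : ∀ (f : X → Formal Y) {N} → IsSubgroup N → IsSubgroup (N ∘ extend f)
preimage-isSubgroup f N = record
  { resp   = λ {c} {d} eq → resp (extend-cong f {c} {d} eq)
  ; []∈    = []∈
  ; ++∈    = λ {c} {d} p q → resp (λ φ → sym (extend-++ f c d φ)) (++∈ p q)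
  ; scale∈ = λ n {c} p → resp (λ φ → sym (extend-scale f n c φ)) (scale∈ n p)
  }
  where open IsSubgroup N

-- Linear combinations, independence and spans

combine : Vector ℤ r → Vector (Formal X) r → Formal X
combine {zero}  a v = []
combine {suc r} a v = scale (a zero) (v zero) ++ combine (a ∘ suc) (v ∘ suc)

combine∈ : {N : Formal X → Set} → IsSubgroup N → ∀ a {v : Vector (Formal X) r} →
  (∀ i → N (v i)) → N (combine a v)
combine∈ {r = zero}  N a v∈ = IsSubgroup.[]∈ N
combine∈ {r = suc r} N a v∈ =
  IsSubgroup.++∈ N (IsSubgroup.scale∈ N (a zero) (v∈ zero)) (combine∈ N (a ∘ suc) (v∈ ∘ suc))

combine-extend : ∀ (f : X → Formal Y) a (v : Vector (Formal X) r) →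
  combine a (extend f ∘ v) ≐ extend f (combine a v)
combine-extend {r = zero}  f a v φ = refl
combine-extend {r = suc r} f a v φ = begin
  eval φ (scale (a zero) (extend f (v zero)) ++ combine (a ∘ suc) (extend f ∘ v ∘ suc))
    ≡⟨ eval-++ φ (scale (a zero) (extend f (v zero))) _ ⟩
  eval φ (scale (a zero) (extend f (v zero))) + eval φ (combine (a ∘ suc) (extend f ∘ v ∘ suc))
    ≡⟨ cong₂ _+_ (sym (extend-scale f (a zero) (v zero) φ)) (combine-extend f (a ∘ suc) (v ∘ suc) φ) ⟩
  eval φ (extend f (scale (a zero) (v zero))) + eval φ (extend f (combine (a ∘ suc) (v ∘ suc)))
    ≡⟨ eval-++ φ (extend f (scale (a zero) (v zero))) _ ⟨
  eval φ (extend f (scale (a zero) (v zero)) ++ extend f (combine (a ∘ suc) (v ∘ suc)))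
    ≡⟨ extend-++ f (scale (a zero) (v zero)) _ φ ⟨
  eval φ (extend f (combine a v))
    ∎
  where open ≡-Reasoning

combine-cong : ∀ a {u v : Vector (Formal X) r} → (∀ i → u i ≐ v i) → combine a u ≐ combine a v
combine-cong {r = zero}  a eq φ = refl
combine-cong {r = suc r} a {u} {v} eq φ =
  trans (eval-scale-++ φ (a zero) (u zero) _)
  (trans (cong₂ (λ s t → a zero * s + t) (eq zero φ) (combine-cong (a ∘ suc) (eq ∘ suc) φ))
  (sym (eval-scale-++ φ (a zero) (v zero) _)))

combine-0 : ∀ {a} → (∀ i → a i ≡ 0ℤ) → (v : Vector (Formal X) r) → combine a v ≐ []
combine-0 {r = zero}  a≡0 v φ = refl
combine-0 {r = suc r} a≡0 v φ = trans (scale-0-++ (a≡0 zero) (v zero) _ φ) (combine-0 (a≡0 ∘ suc) (v ∘ suc) φ)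

Independent : (Formal X → Set) → Vector (Formal X) r → Set
Independent N v = ∀ a → N (combine a v) → ∀ i → a i ≡ 0ℤ

Span : Vector (Formal X) r → Formal X → Set
Span v c = ∃ λ a → combine a v ≐ c

span-isSubgroup : (v : Vector (Formal X) r) → IsSubgroup (Span v)
span-isSubgroup {X = X} v = record
  { resp   = λ eq (a , h) → a , λ φ → trans (h φ) (eq φ)
  ; []∈    = (λ _ → 0ℤ) , combine-0 (λ _ → refl) v
  ; ++∈    = λ {c} {d} (a , h) (b , h′) → (λ i → a i + b i) , λ φ →
      trans (adds a b v φ) (trans (cong₂ _+_ (h φ) (h′ φ)) (sym (eval-++ φ c d)))
  ; scale∈ = λ n {c} (a , h) → (λ i → n * a i) , λ φ →
      trans (scales n a v φ) (trans (cong (n *_) (h φ)) (sym (eval-scale φ n c)))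
  }
  where
    adds : ∀ {r} a b (v : Vector (Formal X) r) φ →
      eval φ (combine (λ i → a i + b i) v) ≡ eval φ (combine a v) + eval φ (combine b v)
    adds {zero}  a b v φ = refl
    adds {suc r} a b v φ =
      trans (eval-scale-++ φ (a zero + b zero) (v zero) _)
      (trans (cong (λ t → (a zero + b zero) * eval φ (v zero) + t) (adds (a ∘ suc) (b ∘ suc) (v ∘ suc) φ))
      (trans (lemma (a zero) (b zero) (eval φ (v zero)) _ _)
      (sym (cong₂ _+_ (eval-scale-++ φ (a zero) (v zero) _) (eval-scale-++ φ (b zero) (v zero) _)))))
      where
        lemma : ∀ p q x s t → (p + q) * x + (s + t) ≡ p * x + s + (q * x + t)
        lemma = solve-∀

    scales : ∀ {r} n a (v : Vector (Formal X) r) φ →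
      eval φ (combine (λ i → n * a i) v) ≡ n * eval φ (combine a v)
    scales {zero}  n a v φ = sym (ℤ.*-zeroʳ n)
    scales {suc r} n a v φ =
      trans (eval-scale-++ φ (n * a zero) (v zero) _)
      (trans (cong (λ t → n * a zero * eval φ (v zero) + t) (scales n (a ∘ suc) (v ∘ suc) φ))
      (trans (lemma n (a zero) (eval φ (v zero)) _)
      (cong (n *_) (sym (eval-scale-++ φ (a zero) (v zero) _)))))
      where
        lemma : ∀ n p x s → n * p * x + n * s ≡ n * (p * x + s)
        lemma = solve-∀

span-tail : (v : Vector (Formal X) (suc r)) → ∀ c → Span (v ∘ suc) c → Span v c
span-tail v _ (a , h) = 0ℤ Vector.∷ a , λ φ → trans (scale-0-++ refl (v zero) _ φ) (h φ)

span-member : (v : Vector (Formal X) r) → ∀ i → Span v (v i)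
span-member {r = suc r} v zero = 1ℤ Vector.∷ (λ _ → 0ℤ) , λ φ →
  trans (eval-scale-++ φ 1ℤ (v zero) _)
  (trans (cong₂ _+_ (ℤ.*-identityˡ (eval φ (v zero))) (combine-0 (λ _ → refl) (v ∘ suc) φ))
  (ℤ.+-identityʳ _))
span-member {r = suc r} v (suc i) = span-tail v (v (suc i)) (span-member (v ∘ suc) i)

independent-tail : {N : Formal X → Set} → IsSubgroup N → (v : Vector (Formal X) (suc r)) →
  Independent N v → Independent N (v ∘ suc)
independent-tail N v ind a h i = ind (0ℤ Vector.∷ a)
  (IsSubgroup.resp N (λ φ → sym (scale-0-++ refl (v zero) (combine a (v ∘ suc)) φ)) h) (suc i)

-- Unfolding the span turns the relation into a combination of `v`. This allows arguments about the
-- leading coefficient alone, with the other coefficients left implicit.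
independent-head : {N : Formal X → Set} → IsSubgroup N → (v : Vector (Formal X) (suc r)) →
  Independent N v → ∀ {n c} → Span (v ∘ suc) c → N (scale n (v zero) ++ c) → n ≡ 0ℤ
independent-head N v ind {n} {c} (a , h) p = ind (n Vector.∷ a) (IsSubgroup.resp N (λ φ →
  trans (eval-scale-++ φ n (v zero) c) (trans (cong (λ t → n * eval φ (v zero) + t) (sym (h φ)))
  (sym (eval-scale-++ φ n (v zero) _)))) p) zero

-- Additivity of ranks

-- A linearly independent family modulo N is traded, up to torsion, for one of the same size
-- that splits into a part independent modulo M and a part inside M.
record Splitting (M N : Formal X → Set) (w : Vector (Formal X) n) : Set where
  field
    {p q}   : ℕ
    u       : Vector (Formal X) p
    v       : Vector (Formal X) q
    size    : p ℕ.+ q ≡ n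
    u-ind   : Independent M u
    v-ind   : Independent N v
    v∈      : ∀ i → M (v i)
    u-span  : ∀ i → Span w (u i)
    v-span  : ∀ i → Span w (v i)

module _ {M N : Formal X → Set} (M-sub : IsSubgroup M) (N-sub : IsSubgroup N) where

  private
    module M = IsSubgroup M-sub
    module N = IsSubgroup N-sub

  -- Induction on the family: either the new vector is independent of `u` modulo `M`, or a relation
  -- involving it gives an element of `M` that takes its place. Excluded middle for this alternative
  -- is what forces the double negation.
  split : (w : Vector (Formal X) n) → Independent N w → ¬ ¬ Splitting M N w
  split {n = zero} w ind k = k record
    { u = w ; v = w ; size = refl ; u-ind = λ _ _ () ; v-ind = λ _ _ ()
    ; v∈ = λ () ; u-span = λ () ; v-span = λ () }
  split {n = suc n} w ind k =
    split (w ∘ suc) (independent-tail N-sub w ind) λ S →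
    let open Splitting S in
    ¬¬-excluded-middle {A = ∃ λ a → a zero ≢ 0ℤ × M (combine a (w zero Vector.∷ u))} λ
      { (yes (a , a≢0 , h)) → k (torsion S a a≢0 h)
      ; (no none) → k (free S λ a h → decidable-stable (a zero ℤ.≟ 0ℤ) λ a≢0 → none (a , a≢0 , h))
      }
    where
    module _ (S : Splitting M N (w ∘ suc)) where
      open Splitting S

      free : (∀ a → M (combine a (w zero Vector.∷ u)) → a zero ≡ 0ℤ) → Splitting M N w
      free a₀≡0 = record
        { u = w zero Vector.∷ u ; v = v ; size = cong suc size ; u-ind = ind′ ; v-ind = v-ind
        ; v∈ = v∈
        ; u-span = λ { zero → span-member w zero ; (suc i) → span-tail w (u i) (u-span i) }
        ; v-span = λ i → span-tail w (v i) (v-span i) }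
        where
        ind′ : Independent M (w zero Vector.∷ u)
        ind′ a h zero    = a₀≡0 a h
        ind′ a h (suc i) = u-ind (a ∘ suc)
          (M.resp (scale-0-++ (a₀≡0 a h) (w zero) (combine (a ∘ suc) u)) h) i

      -- The relation itself joins `v` in place of `w zero`. It contains `w zero` with the nonzero
      -- factor `a zero`, and everything else lies in the span of the tail, so independence survives
      -- because ℤ has no zero divisors.
      torsion : ∀ a → a zero ≢ 0ℤ → M (combine a (w zero Vector.∷ u)) → Splitting M N w
      torsion a a≢0 h = record
        { u = u ; v = y Vector.∷ v ; size = trans (ℕ.+-suc _ _) (cong suc size) ; u-ind = u-ind
        ; v-ind = ind′
        ; v∈ = λ { zero → h ; (suc i) → v∈ i }
        ; u-span = λ i → span-tail w (u i) (u-span i)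
        ; v-span = λ { zero → y-span ; (suc i) → span-tail w (v i) (v-span i) } }
        where
        module Span′ = IsSubgroup (span-isSubgroup (w ∘ suc))
        y = combine a (w zero Vector.∷ u)
        z = combine (a ∘ suc) u

        y-span : Span w y
        y-span = combine∈ (span-isSubgroup w) a {w zero Vector.∷ u}
          λ { zero → span-member w zero ; (suc i) → span-tail w (u i) (u-span i) }

        z-span : Span (w ∘ suc) z
        z-span = combine∈ (span-isSubgroup (w ∘ suc)) (a ∘ suc) u-span

        ind′ : Independent N (y Vector.∷ v)
        ind′ b h′ = λ { zero → b≡0 ; (suc i) → v-ind (b ∘ suc)
            (N.resp (scale-0-++ b≡0 y (combine (b ∘ suc) v)) h′) i }
          where
          lemma : ∀ b a x z v → b * (a * x + z) + v ≡ b * a * x + (b * z + v)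
          lemma = solve-∀

          ba≡0 : b zero * a zero ≡ 0ℤ
          ba≡0 = independent-head N-sub w ind {n = b zero * a zero}
            {c = scale (b zero) z ++ combine (b ∘ suc) v}
            (Span′.++∈ {scale (b zero) z} (Span′.scale∈ (b zero) {z} z-span)
              (combine∈ (span-isSubgroup (w ∘ suc)) (b ∘ suc) v-span))
            (N.resp (λ φ → begin
              eval φ (scale (b zero) y ++ combine (b ∘ suc) v)
                ≡⟨ eval-scale-++ φ (b zero) y _ ⟩
              b zero * eval φ y + eval φ (combine (b ∘ suc) v)
                ≡⟨ cong (λ t → b zero * t + eval φ (combine (b ∘ suc) v)) (eval-scale-++ φ (a zero) (w zero) z) ⟩
              b zero * (a zero * eval φ (w zero) + eval φ z) + eval φ (combine (b ∘ suc) v)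
                ≡⟨ lemma (b zero) (a zero) (eval φ (w zero)) (eval φ z) _ ⟩
              b zero * a zero * eval φ (w zero) + (b zero * eval φ z + eval φ (combine (b ∘ suc) v))
                ≡⟨ cong (λ t → b zero * a zero * eval φ (w zero) + t) (eval-scale-++ φ (b zero) z _) ⟨
              b zero * a zero * eval φ (w zero) + eval φ (scale (b zero) z ++ combine (b ∘ suc) v)
                ≡⟨ eval-scale-++ φ (b zero * a zero) (w zero) _ ⟨
              eval φ (scale (b zero * a zero) (w zero) ++ (scale (b zero) z ++ combine (b ∘ suc) v))
                ∎) h′)
            where open ≡-Reasoning

          b≡0 : b zero ≡ 0ℤ
          b≡0 = ℤ.*-cancelʳ-≡ (b zero) 0ℤ (a zero) {{≢-nonZero a≢0}} ba≡0

-- r is the rank of Z / (Z ∩ N).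
record RankModulo (Z N : Formal X → Set) (r : ℕ) : Set where
  field
    basis       : Vector (Formal X) r
    basis∈      : ∀ i → Z (basis i)
    independent : Independent N basis
    maximal     : ∀ {s} (v : Vector (Formal X) s) → (∀ i → Z (v i)) → Independent N v → s ℕ.≤ r

RankModulo-unique : {A B : Formal X → Set} → RankModulo A B r → RankModulo A B s → r ≡ s
RankModulo-unique R S = ℕ.≤-antisym
  (S.maximal R.basis R.basis∈ R.independent) (R.maximal S.basis S.basis∈ S.independent)
  where
    module R = RankModulo R
    module S = RankModulo S

-- Recursion on the first family keeps step with `combine`, so that `combine-append` is an equality
-- of lists.
append : Vector X m → Vector X n → Vector X (m ℕ.+ n)
append {m = zero}  u v         = v
append {m = suc m} u v zero    = u zero
append {m = suc m} u v (suc i) = append (u ∘ suc) v i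

append-All : ∀ {P : X → Set} (u : Vector X m) {v : Vector X n} → (∀ i → P (u i)) → (∀ i → P (v i)) →
  ∀ i → P (append u v i)
append-All {m = zero}  u hu hv i       = hv i
append-All {m = suc m} u hu hv zero    = hu zero
append-All {m = suc m} {P = P} u hu hv (suc i) = append-All {P = P} (u ∘ suc) (hu ∘ suc) hv i

↑-All : ∀ {P : Fin (m ℕ.+ n) → Set} → (∀ i → P (i ↑ˡ n)) → (∀ i → P (m ↑ʳ i)) → ∀ i → P i
↑-All {m = zero}  hu hv i       = hv i
↑-All {m = suc m} hu hv zero    = hu zero
↑-All {m = suc m} {P = P} hu hv (suc i) = ↑-All {m = m} {P = P ∘ suc} (hu ∘ suc) hv i

combine-append : ∀ a (u : Vector (Formal X) m) (v : Vector (Formal X) n) →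
  combine a (append u v) ≡ combine (λ i → a (i ↑ˡ n)) u ++ combine (λ i → a (m ↑ʳ i)) v
combine-append {m = zero}  a u v = refl
combine-append {m = suc m} a u v =
  trans (cong (scale (a zero) (u zero) ++_) (combine-append (a ∘ suc) (u ∘ suc) v))
        (sym (List.++-assoc (scale (a zero) (u zero)) _ _))

-- A basis modulo `M` and a basis of the part inside `M` are joined; conversely, a splitting bounds
-- the size of any independent family by the two ranks.
rank-additive : {A M N : Formal X → Set} → IsSubgroup A → IsSubgroup M → IsSubgroup N →
  (∀ {c} → N c → M c) → RankModulo A M r → RankModulo (A ∩ M) N s → RankModulo A N (r ℕ.+ s)
rank-additive {X = X} {r = r} {s = s} {A = A} {M} {N} A-sub M-sub N-sub N⊆M R S = record
  { basis       = append R.basis S.basis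
  ; basis∈      = append-All {P = A} R.basis R.basis∈ (proj₁ ∘ S.basis∈)
  ; independent = λ a h →
      let h′ = subst N (combine-append a R.basis S.basis) h
          -- Modulo `M` the second half of the combination vanishes and can be subtracted.
          b≡0 = R.independent (λ i → a (i ↑ˡ s)) (M.resp (cancelʳ (combine (λ i → a (i ↑ˡ s)) R.basis) _)
            (M.++∈ (N⊆M h′) (M.scale∈ -1ℤ (combine∈ M-sub (λ i → a (r ↑ʳ i)) (proj₂ ∘ S.basis∈)))))
          c≡0 = S.independent (λ i → a (r ↑ʳ i)) (N.resp (λ φ →
            trans (eval-++ φ (combine (λ i → a (i ↑ˡ s)) R.basis) _)
            (trans (cong (_+ _) (combine-0 b≡0 R.basis φ)) (ℤ.+-identityˡ _))) h′)
      in ↑-All {P = λ i → a i ≡ 0ℤ} b≡0 c≡0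
  -- The inequality is decidable, hence stable, and may be proved from a doubly negated splitting.
  ; maximal     = λ v v∈ ind → decidable-stable (_ ℕ.≤? _) λ v≰ →
      split M-sub N-sub v ind (v≰ ∘ bound v v∈)
  }
  where
    module R = RankModulo R
    module S = RankModulo S
    module M = IsSubgroup M-sub
    module N = IsSubgroup N-sub

    span⇒∈ : ∀ {n} {v : Vector (Formal X) n} → (∀ i → A (v i)) → ∀ {c} → Span v c → A c
    span⇒∈ v∈ (a , h) = IsSubgroup.resp A-sub h (combine∈ A-sub a v∈)

    bound : ∀ {n} (v : Vector (Formal X) n) → (∀ i → A (v i)) → Splitting M N v → n ℕ.≤ r ℕ.+ s
    bound v v∈A T = subst (ℕ._≤ r ℕ.+ s) T.size (ℕ.+-mono-≤
      (R.maximal T.u (span⇒∈ v∈A ∘ T.u-span) T.u-ind)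
      (S.maximal T.v (λ i → span⇒∈ v∈A (T.v-span i) , T.v∈ i) T.v-ind))
      where module T = Splitting T

    cancelʳ : ∀ c d → (c ++ d) ++ scale -1ℤ d ≐ c
    cancelʳ c d φ = trans (eval-++ φ (c ++ d) _)
      (trans (cong₂ _+_ (eval-++ φ c d) (eval-scale φ -1ℤ d)) (lemma (eval φ c) (eval φ d)))
      where
        lemma : ∀ x y → x + y + -1ℤ * y ≡ x
        lemma = solve-∀


-- Ranks split by a family of maps with sections

module _ {B : Set} {Y : B → Set} (φ : ∀ b → X → Formal (Y b)) (ψ : ∀ b → Y b → Formal X)
         {A′ N′ : ∀ b → Formal (Y b) → Set} (N′-sub : ∀ b → IsSubgroup (N′ b))
         {ranks : B → ℕ} (R : ∀ b → RankModulo (A′ b) (N′ b) (ranks b))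
         {G : B → Set}
         (φψ≐id : ∀ {b} → G b → ∀ c → extend (φ b) (extend (ψ b) c) ≐ c)
         (φψ≐0 : ∀ {b b′} → G b → G b′ → b ≢ b′ → ∀ c → extend (φ b) (extend (ψ b′) c) ≐ [])
         where

  private
    M : ∀ b → Formal X → Set
    M b = N′ b ∘ extend (φ b)

    M-sub : ∀ b → IsSubgroup (M b)
    M-sub b = preimage-isSubgroup (φ b) (N′-sub b)

  -- `φ b` induces an isomorphism of quotients: it is injective because `M b` is the full preimage
  -- of `N′ b`, and surjective because `ψ b` is a section. Bases are therefore moved by `ψ b`,
  -- independent families by `φ b`.
  rank-preimage : ∀ {b} → G b → {A : Formal X → Set} →
    (∀ {c} → A c → A′ b (extend (φ b) c)) → (∀ {c} → A′ b c → A (extend (ψ b) c)) →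
    RankModulo A (M b) (ranks b)
  rank-preimage {b} Gb φ∈ ψ∈ = record
    { basis       = extend (ψ b) ∘ basis
    ; basis∈      = ψ∈ ∘ basis∈
    ; independent = λ a h → independent a (resp (λ θ →
        trans (sym (combine-extend (φ b) a (extend (ψ b) ∘ basis) θ))
              (combine-cong a (φψ≐id Gb ∘ basis) θ)) h)
    ; maximal     = λ v v∈ ind → maximal (extend (φ b) ∘ v) (φ∈ ∘ v∈)
        λ a h → ind a (resp (combine-extend (φ b) a v) h)
    }
    where
      open RankModulo (R b)
      open IsSubgroup (N′-sub b)

  -- Each step splits off one map and shrinks `A` to `A ∩ M b`. The remaining sections still land
  -- there by `φψ≐0`, while `ψ b` itself may not; hence `ψ∈` is required only for the maps still to
  -- come.
  rank-sum : ∀ {bs} → Unique bs → All G bs → {A N : Formal X → Set} → IsSubgroup A → IsSubgroup N →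
    (∀ {b} → G b → ∀ {c} → A c → A′ b (extend (φ b) c)) →
    All (λ b → ∀ {c} → A′ b c → A (extend (ψ b) c)) bs →
    (∀ {b} → G b → ∀ {c} → N c → M b c) →
    (∀ c → A c → (∀ {b} → b ∈ bs → M b c) → N c) →
    RankModulo A N (sum (map ranks bs))
  rank-sum [] [] A-sub N-sub φ∈ ψ∈ N⊆M injective = record
    { basis       = λ ()
    ; basis∈      = λ ()
    ; independent = λ _ _ ()
    -- With no maps left, `injective` puts `A` inside `N`, so even the combination with all
    -- coefficients 1 is a relation.
    ; maximal     = λ { {zero} v v∈ ind → ℕ.z≤n ; {suc s} v v∈ ind → contradiction
        (ind (λ _ → 1ℤ) (injective _ (combine∈ A-sub (λ _ → 1ℤ) v∈) λ ()) zero) λ () }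
    }
  rank-sum {b ∷ bs} (b∉ ∷ u) (Gb ∷ Gbs) A-sub N-sub φ∈ (ψ∈ ∷ ψs∈) N⊆M injective =
    rank-additive A-sub (M-sub b) N-sub (λ {c} → N⊆M Gb {c}) (rank-preimage Gb (φ∈ Gb) ψ∈)
      (rank-sum u Gbs (∩-isSubgroup A-sub (M-sub b)) N-sub (λ Gb′ → φ∈ Gb′ ∘ proj₁)
        (All.zipWith (λ ((b≢b′ , Gb′) , ψ∈) {c} p → ψ∈ p ,
           IsSubgroup.resp (N′-sub b) (λ θ → sym (φψ≐0 Gb Gb′ b≢b′ c θ)) (IsSubgroup.[]∈ (N′-sub b)))
          (All.zip (b∉ , Gbs) , ψs∈))
        N⊆M
        λ c (p , q) h → injective c p λ { (here refl) → q ; (there b′∈) → h b′∈ })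

-- Homology as cycles modulo boundaries

module _ {X Y Z : Set} (f : X → Formal Y) (g : Y → Formal Z)
         (finiteX : IsFinite X) (finiteY : IsFinite Y) (finiteZ : IsFinite Z) where
  private
    module H = Homology f g finiteX finiteY finiteZ
    module X = IsFinite finiteX
    module Y = IsFinite finiteY
    module Z = IsFinite finiteZ
  open Rank H.homologyGroup
  open AbelianGroup H.homologyGroup using (rawMonoid)
  open RawMonoidDefs rawMonoid using () renaming (_×_ to _×ᴺ_; sum to sumᴴ)

  IsZero : Formal Y → Set
  IsZero c = ∀ φ → eval (λ y → eval φ (g y)) c ≡ 0ℤ

  IsBoundary : Formal Y → Set
  IsBoundary c = ∃ λ w → ∀ φ → eval φ c ≡ eval (λ x → eval φ (f x)) w

  IsZero-isSubgroup : IsSubgroup IsZero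
  IsZero-isSubgroup = record
    { resp   = λ eq p φ → trans (sym (eq _)) (p φ)
    ; []∈    = λ _ → refl
    ; ++∈    = λ {c} {d} p q φ → trans (eval-++ _ c d) (cong₂ _+_ (p φ) (q φ))
    ; scale∈ = λ n {c} p φ → trans (eval-scale _ n c) (trans (cong (n *_) (p φ)) (ℤ.*-zeroʳ n))
    }

  IsBoundary-isSubgroup : IsSubgroup IsBoundary
  IsBoundary-isSubgroup = record
    { resp   = λ eq (w , h) → w , λ φ → trans (sym (eq φ)) (h φ)
    ; []∈    = [] , λ _ → refl
    ; ++∈    = λ {c} {d} (w , h) (w′ , h′) → w ++ w′ , λ φ →
        trans (eval-++ φ c d) (trans (cong₂ _+_ (h φ) (h′ φ)) (sym (eval-++ _ w w′)))
    ; scale∈ = λ n {c} (w , h) → scale n w , λ φ →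
        trans (eval-scale φ n c) (trans (cong (n *_) (h φ)) (sym (eval-scale _ n w)))
    }

  private
    eval-×ᴺ : ∀ φ n c → eval φ (proj₁ (n ×ᴺ c)) ≡ + n * eval φ (proj₁ c)
    eval-×ᴺ φ zero    c = refl
    eval-×ᴺ φ (suc n) c = trans (eval-++ φ (proj₁ c) _)
      (trans (cong (λ t → eval φ (proj₁ c) + t) (eval-×ᴺ φ n c)) (sym (ℤ.suc-* (+ n) _)))

    eval-· : ∀ φ n c → eval φ (proj₁ (n · c)) ≡ n * eval φ (proj₁ c)
    eval-· φ (+ n)    c = eval-×ᴺ φ n c
    eval-· φ -[1+ n ] c = trans (eval-scale φ -1ℤ (proj₁ (suc n ×ᴺ c)))
      (trans (cong (-1ℤ *_) (eval-×ᴺ φ (suc n) c))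
      (trans (ℤ.-1*i≡-i _) (ℤ.neg-distribˡ-* (+ suc n) _)))

    combination : ∀ {r} (a : Fin r → ℤ) (v : Fin r → H.Cycle) →
      proj₁ (sumᴴ λ i → a i · v i) ≐ combine a (proj₁ ∘ v)
    combination {zero}  a v φ = refl
    combination {suc r} a v φ = trans (eval-++ φ (proj₁ (a zero · v zero)) _)
      (trans (cong₂ _+_ (eval-· φ (a zero) (v zero)) (combination (a ∘ suc) (v ∘ suc) φ))
      (sym (eval-scale-++ φ (a zero) (proj₁ (v zero)) _)))

  -- Homology compares coefficients, `RankModulo` all functionals; over finite bases the two agree
  -- by `eval-≈`.
  IsRank⇒RankModulo : ∀ {r} → IsRank r → RankModulo IsZero IsBoundary r
  IsRank⇒RankModulo ((v , v-ind) , bound) = record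
    { basis       = proj₁ ∘ v
    ; basis∈      = λ i φ → trans (sym (eval-extend φ g (proj₁ (v i))))
        (Z.eval-≈ φ {extend g (proj₁ (v i))} {[]} (proj₂ (v i)))
    ; independent = λ a (w , h) → v-ind a (w , λ y →
        trans (cong (eval (Y.δ y)) (List.++-identityʳ (proj₁ (sumᴴ λ i → a i · v i))))
        (trans (combination a v (Y.δ y)) (trans (h (Y.δ y)) (sym (eval-extend (Y.δ y) f w)))))
    ; maximal     = λ u u∈ ind →
        let u′ = λ i → u i , λ z → trans (eval-extend (Z.δ z) g (u i)) (u∈ i (Z.δ z))
        in bound _ u′ λ a (w , h) → ind a (w , λ φ →
          trans (sym (combination a u′ φ))
          (trans (cong (eval φ) (sym (List.++-identityʳ (proj₁ (sumᴴ λ i → a i · u′ i)))))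
          (trans (Y.eval-≈ φ {proj₁ (sumᴴ λ i → a i · u′ i) ++ []} {extend f w} h) (eval-extend φ f w))))
    }

-- Coboundaries on lists and chain groups

-- The alternating sum of Θ over the faces of a list.
D : (List X → ℤ) → List X → ℤ
D Θ []      = 0ℤ
D Θ (x ∷ v) = Θ v - D (Θ ∘ (x ∷_)) v

-- Deleting an entry preserves `All P`, so agreement on such lists already covers all faces.
D-cong : ∀ {Θ Θ′ : List X → ℤ} {P : X → Set} → (∀ {v} → All P v → Θ v ≡ Θ′ v) →
  ∀ {v} → All P v → D Θ v ≡ D Θ′ v
D-cong eq []       = refl
D-cong eq (p ∷ ps) = cong₂ _-_ (eq ps) (D-cong (eq ∘ (p ∷_)) ps)

D-0 : ∀ {Θ : List X → ℤ} → (∀ v → Θ v ≡ 0ℤ) → ∀ v → D Θ v ≡ 0ℤ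
D-0 eq []      = refl
D-0 eq (x ∷ v) = cong₂ _-_ (eq v) (D-0 (λ u → eq (x ∷ u)) v)

D-* : ∀ n (Θ : List X → ℤ) v → D (λ u → n * Θ u) v ≡ n * D Θ v
D-* n Θ []      = sym (ℤ.*-zeroʳ n)
D-* n Θ (x ∷ v) = trans (cong (λ t → n * Θ v - t) (D-* n (Θ ∘ (x ∷_)) v)) (lemma n (Θ v) _)
  where
    lemma : ∀ n a b → n * a - n * b ≡ n * (a - b)
    lemma = solve-∀

D-- : ∀ (Θ Θ′ : List X → ℤ) v → D (λ u → Θ u - Θ′ u) v ≡ D Θ v - D Θ′ v
D-- Θ Θ′ []      = refl
D-- Θ Θ′ (x ∷ v) =
  trans (cong (λ t → Θ v - Θ′ v - t) (D-- (Θ ∘ (x ∷_)) (Θ′ ∘ (x ∷_)) v)) (lemma (Θ v) (Θ′ v) _ _)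
  where
    lemma : ∀ a a′ b b′ → a - a′ - (b - b′) ≡ a - b - (a′ - b′)
    lemma = solve-∀

module _ (Q : FinitePoset) (k : ℕ) where

  -- `k` counts the elements of a chain, so the homological dimension is `k - 1`.
  ChainCycles ChainBoundaries : Formal (OrderComplex.Chain Q k) → Set
  ChainCycles     = IsZero (OrderComplex.boundary Q (suc k)) (OrderComplex.boundary Q k)
    (OrderComplex.chain-isFinite Q (suc k)) (OrderComplex.chain-isFinite Q k)
    (OrderComplex.chain-isFinite Q (ℕ.pred k))
  ChainBoundaries = IsBoundary (OrderComplex.boundary Q (suc k)) (OrderComplex.boundary Q k)
    (OrderComplex.chain-isFinite Q (suc k)) (OrderComplex.chain-isFinite Q k)
    (OrderComplex.chain-isFinite Q (ℕ.pred k))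

  ChainCycles-isSubgroup : IsSubgroup ChainCycles
  ChainCycles-isSubgroup = IsZero-isSubgroup (OrderComplex.boundary Q (suc k)) (OrderComplex.boundary Q k)
    (OrderComplex.chain-isFinite Q (suc k)) (OrderComplex.chain-isFinite Q k)
    (OrderComplex.chain-isFinite Q (ℕ.pred k))

  ChainBoundaries-isSubgroup : IsSubgroup ChainBoundaries
  ChainBoundaries-isSubgroup = IsBoundary-isSubgroup (OrderComplex.boundary Q (suc k)) (OrderComplex.boundary Q k)
    (OrderComplex.chain-isFinite Q (suc k)) (OrderComplex.chain-isFinite Q k)
    (OrderComplex.chain-isFinite Q (ℕ.pred k))

  hasRankModulo : RankModulo ChainCycles ChainBoundaries (proj₁ (OrderComplex.hasRank Q k))
  hasRankModulo = IsRank⇒RankModulo (OrderComplex.boundary Q (suc k)) (OrderComplex.boundary Q k)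
    (OrderComplex.chain-isFinite Q (suc k)) (OrderComplex.chain-isFinite Q k)
    (OrderComplex.chain-isFinite Q (ℕ.pred k))
    (proj₂ (OrderComplex.hasRank Q k))

-- Chains of an induced subposet as lists

-- Q sits inside P as the induced subposet on S; its chains are listed by their elements in P,
-- so that integer functionals on lists restrict to the chains of every such Q at once.
module Subposet (P Q : FinitePoset) (ι : FinitePoset.Carrier Q → FinitePoset.Carrier P)
  (ι-injective : ∀ {x y} → ι x ≡ ι y → x ≡ y)
  (ι-mono : ∀ {x y} → FinitePoset._≤_ Q x y → FinitePoset._≤_ P (ι x) (ι y))
  (ι-reflects : ∀ {x y} → FinitePoset._≤_ P (ι x) (ι y) → FinitePoset._≤_ Q x y)
  (S : FinitePoset.Carrier P → Set) (ι∈ : ∀ x → S (ι x)) (ι-onto : ∀ {x} → S x → ∃ λ y → ι y ≡ x) where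

  private
    module P = FinitePoset P
    module Q = FinitePoset Q

  open OrderComplex Q public using (Chain; boundary)
  open OrderComplex Q using (Increasing; chain-isFinite; face)

  list : Vec Q.Carrier n → List P.Carrier
  list v = List.map ι (Vec.toList v)

  elems : Chain n → List P.Carrier
  elems σ = list (value σ)

  ι-mono-< : ∀ {x y} → x Q.< y → ι x P.< ι y
  ι-mono-< (x≤y , x≢y) = ι-mono x≤y , x≢y ∘ ι-injective

  ι-reflects-< : ∀ {x y} → ι x P.< ι y → x Q.< y
  ι-reflects-< (x≤y , x≢y) = ι-reflects x≤y , x≢y ∘ cong ι

  elems-injective : {σ τ : Chain n} → elems σ ≡ elems τ → σ ≡ τ
  elems-injective {σ = σ} {τ} eq = value-injective
    (trans (sym (Vec.cast-is-id refl (value σ)))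
      (Vec.toList-injective refl (value σ) (value τ) (List.map-injective ι-injective eq)))

  elems-length : (σ : Chain n) → List.length (elems σ) ≡ n
  elems-length σ = trans (List.length-map ι (Vec.toList (value σ))) (Vec.length-toList (value σ))

  elems-∈ : (σ : Chain n) → All S (elems σ)
  elems-∈ σ = AllP.map⁺ (All.universal ι∈ (Vec.toList (value σ)))

  elems-increasing : (σ : Chain n) → AllPairs P._<_ (elems σ)
  elems-increasing (v , [ h ]) =
    AllPairsP.map⁺ (AllPairs.map ι-mono-< (toList⁺ (recompute (VecAllPairs.allPairs? Q._<?_ v) h)))
    where
      toList⁺ : ∀ {n} {v : Vec Q.Carrier n} → Increasing v → AllPairs Q._<_ (Vec.toList v)
      toList⁺ []      = []
      toList⁺ (p ∷ h) = VecAllP.toList⁺ p ∷ toList⁺ h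

  elems-onto : ∀ {l} → List.length l ≡ n → AllPairs P._<_ l → All S l →
    ∃ λ (σ : Chain n) → elems σ ≡ l
  elems-onto len inc l∈ with onto len inc l∈
    where
      onto : ∀ {n l} → List.length l ≡ n → AllPairs P._<_ l → All S l →
        ∃ λ (v : Vec Q.Carrier n) → Increasing v × list v ≡ l
      onto {zero}  len [] [] = [] , [] , refl
      onto {suc n} len (p ∷ inc) (x∈ ∷ l∈) with ι-onto x∈ | onto (ℕ.suc-injective len) inc l∈
      ... | y , refl | v , inc′ , refl =
        y ∷ v , VecAllP.toList⁻ (All.map ι-reflects-< (AllP.map⁻ p)) ∷ inc′ , refl
  ... | v , inc′ , eq = (v , [ inc′ ]) , eq

  -- The chain with the given elements, or 0 if there is none.
  chain : ∀ n → List P.Carrier → Formal (Chain n)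
  chain n l with Any.any? (λ σ → List.≡-dec P._≟_ (elems σ) l) (IsFinite.elements (chain-isFinite n))
  ... | yes p = (1ℤ , proj₁ (Any.satisfied p)) ∷ []
  ... | no  _ = []

  -- The search need not return the given `σ`, so the value of `θ` is prescribed on every chain with
  -- elements `l`.
  eval-chain : ∀ {l} {θ : Chain n → ℤ} {t} → (∃ λ σ → elems σ ≡ l) →
    (∀ σ → elems σ ≡ l → θ σ ≡ t) → eval θ (chain n l) ≡ t
  eval-chain {n = n} {l} (σ , eq) h
    with Any.any? (λ σ → List.≡-dec P._≟_ (elems σ) l) (IsFinite.elements (chain-isFinite n))
  ... | yes p = trans (ℤ.+-identityʳ _) (trans (ℤ.*-identityˡ _)
                  (h (proj₁ (Any.satisfied p)) (proj₂ (Any.satisfied p))))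
  ... | no ¬p = contradiction
    (Any.map (λ { refl → eq }) (IsFinite.complete (chain-isFinite n) σ)) ¬p

  evalˡ : (List P.Carrier → ℤ) → Formal (Chain n) → ℤ
  evalˡ Θ = eval (Θ ∘ elems)

  evalˡ-chain : ∀ Θ {l} → List.length l ≡ n → AllPairs P._<_ l → All S l → evalˡ Θ (chain n l) ≡ Θ l
  evalˡ-chain Θ len inc l∈ = eval-chain (elems-onto len inc l∈) λ _ → cong Θ

  -- Extension by zero to lists that are no chain. Every functional on chains is thus the
  -- restriction of one on lists, and testing with `evalˡ` loses nothing.
  extension : (Chain n → ℤ) → List P.Carrier → ℤ
  extension {n} θ l = eval θ (chain n l)

  extension-elems : ∀ (θ : Chain n → ℤ) σ → extension θ (elems σ) ≡ θ σ
  extension-elems θ σ = eval-chain (σ , refl) λ τ eq → cong θ (elems-injective eq)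

  evalˡ-extension : ∀ (θ : Chain n → ℤ) c → evalˡ (extension θ) c ≡ eval θ c
  evalˡ-extension θ = eval-cong (extension-elems θ)

  evalˡ-≐ : ∀ (c d : Formal (Chain n)) → (∀ Θ → evalˡ Θ c ≡ evalˡ Θ d) → c ≐ d
  evalˡ-≐ c d h θ =
    trans (sym (evalˡ-extension θ c)) (trans (h (extension θ)) (evalˡ-extension θ d))

  evalˡ-boundary : ∀ k (Θ : List P.Carrier → ℤ) σ → evalˡ Θ (boundary k σ) ≡ D Θ (elems σ)
  evalˡ-boundary zero    Θ ([] , _) = refl
  evalˡ-boundary (suc k) Θ σ@(v , _) = trans
    (faces {θ = Θ ∘ elems} 1ℤ (λ j → -1ℤ ^ toℕ j) (face σ)
      (λ j → sym (ℤ.*-identityˡ (-1ℤ ^ toℕ j))) Θ v λ _ → refl)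
    (ℤ.*-identityˡ _)
    where
      -- The factor `s` is the sign accumulated from the vertices already passed; without it the
      -- induction would not close, since the tail starts with the opposite sign.
      faces : ∀ {k} {X : Set} {θ : X → ℤ} s (m : Fin (suc k) → ℤ) (t : Fin (suc k) → X) →
        (∀ j → m j ≡ s * -1ℤ ^ toℕ j) → ∀ Θ (v : Vec Q.Carrier (suc k)) →
        (∀ j → θ (t j) ≡ Θ (list (removeAt v j))) →
        eval θ (List.tabulate λ j → m j , t j) ≡ s * D Θ (list v)
      faces {zero} s m t hm Θ (x ∷ []) h =
        trans (cong (_+ 0ℤ) (cong₂ _*_ (hm zero) (h zero))) (lemma s (Θ []))
        where
          lemma : ∀ s a → s * 1ℤ * a + 0ℤ ≡ s * (a - 0ℤ)
          lemma = solve-∀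
      faces {suc k} {θ = θ} s m t hm Θ (x ∷ v@(_ ∷ _)) h =
        trans (cong₂ _+_ (cong₂ _*_ (hm zero) (h zero))
          (faces {θ = θ} (s * -1ℤ) (m ∘ suc) (t ∘ suc)
            (λ j → trans (hm (suc j)) (sym (ℤ.*-assoc s -1ℤ (-1ℤ ^ toℕ j)))) (Θ ∘ (ι x ∷_)) v (h ∘ suc)))
        (lemma s (Θ (list v)) _)
        where
          lemma : ∀ s a b → s * 1ℤ * a + s * -1ℤ * b ≡ s * (a - b)
          lemma = solve-∀

  eval-boundary : ∀ k (θ : Chain (ℕ.pred k) → ℤ) σ → eval θ (boundary k σ) ≡ D (extension θ) (elems σ)
  eval-boundary k θ σ =
    trans (sym (evalˡ-extension θ (boundary k σ))) (evalˡ-boundary k (extension θ) σ)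

  module _ (k : ℕ) where

    -- Here `D` plays the coboundary: this and the next three lemmas pass between chain functionals
    -- and list functionals by extending with zero or restricting along `elems`.
    cycle⁺ : ∀ c → (∀ Θ → evalˡ (D Θ) c ≡ 0ℤ) → ChainCycles Q k c
    cycle⁺ c h θ = trans (eval-cong (eval-boundary k θ) c) (h (extension θ))

    cycle⁻ : ∀ c → ChainCycles Q k c → ∀ Θ → evalˡ (D Θ) c ≡ 0ℤ
    cycle⁻ c h Θ = trans (sym (eval-cong (evalˡ-boundary k Θ) c)) (h (Θ ∘ elems))

    boundary⁺ : ∀ c w → (∀ Θ → evalˡ Θ c ≡ evalˡ (D Θ) w) → ChainBoundaries Q k c
    boundary⁺ c w h = w , λ θ → trans (sym (evalˡ-extension θ c))
      (trans (h (extension θ)) (sym (eval-cong (eval-boundary (suc k) θ) w)))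

    boundary⁻ : ∀ c → ((w , _) : ChainBoundaries Q k c) → ∀ Θ → evalˡ Θ c ≡ evalˡ (D Θ) w
    boundary⁻ _ (w , h) Θ = trans (h (Θ ∘ elems)) (eval-cong (evalˡ-boundary (suc k) Θ) w)

-- Atoms of a bounded interval order

module AtomLemmas (P : BoundedPoset) where
  private module P = BoundedPoset P
  open BoundedPoset P using (Carrier; _<_; _<?_; _≟_; _≺_; 0̂; 1̂; IsAtom; IsSmallestAtom)

  <-trans : ∀ {x y z} → x < y → y < z → x < z
  <-trans = ToStrict.<-trans _≡_ P._≤_ P.isPartialOrder

  <-≤-trans : ∀ {x y z} → x < y → y P.≤ z → x < z
  <-≤-trans = ToStrict.<-≤-trans _≡_ P._≤_ sym P.≤-trans P.≤-antisym (λ { refl → id })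

  <-irrefl : ∀ {x} → ¬ (x < x)
  <-irrefl (_ , x≢x) = x≢x refl

  -- The candidate is replaced whenever the list offers a smaller one. The bound `m P.≤ x` carries
  -- the exclusion of each passed element over to the final candidate.
  minimal : ∀ {S : Carrier → Set} → Unary.Decidable S → ∀ xs {x} → S x →
    ∃ λ m → S m × m P.≤ x × All (λ y → ¬ (S y × y < m)) xs
  minimal S? [] Sx = _ , Sx , P.≤-refl , []
  minimal S? (y ∷ xs) {x} Sx with S? y ×-dec y <? x
  ... | yes (Sy , y<x) = let m , Sm , m≤y , min = minimal S? xs Sy in
    m , Sm , P.≤-trans m≤y (proj₁ y<x) , (λ (_ , y<m) → <-irrefl (<-≤-trans y<m m≤y)) ∷ min
  ... | no  ¬y<x = let m , Sm , m≤x , min = minimal S? xs Sx in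
    m , Sm , m≤x , (λ (Sy , y<m) → ¬y<x (Sy , <-≤-trans y<m m≤x)) ∷ min

  0< : ∀ {x} → x ≢ 0̂ → 0̂ < x
  0< x≢0̂ = P.minimum _ , x≢0̂ ∘ sym

  atom-below : ∀ {x} → x ≢ 0̂ → ∃ λ a → IsAtom a × a P.≤ x
  atom-below x≢0̂ = let a , 0<a , a≤x , min = minimal (0̂ <?_) P.elements (0< x≢0̂) in
    a , (0<a , λ z → All.lookup min (P.complete z)) , a≤x

  ≮-atom : ∀ {x a} → x ≢ 0̂ → IsAtom a → ¬ (x < a)
  ≮-atom x≢0̂ (_ , min) x<a = min _ (0< x≢0̂ , x<a)

  atom≢0̂ : ∀ {a} → IsAtom a → a ≢ 0̂
  atom≢0̂ ((_ , 0≢a) , _) = 0≢a ∘ sym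

  -- In a full chain of at least two steps the second vertex lies strictly between `0̂` and `1̂`.
  atom≢1̂ : ∀ {ℓ} → P.HasLength ℓ → 2 ℕ.≤ ℓ → ∀ {a} → IsAtom a → a ≢ 1̂
  atom≢1̂ ((γ , refl) , _) 2≤ℓ (_ , min) refl = no-middle γ 2≤ℓ
    where
      no-middle : ∀ (γ : P.FullChain) → ¬ (2 ℕ.≤ P.steps γ)
      no-middle (_ ◅ ε) (ℕ.s≤s ())
      no-middle (0<x ◅ x<y ◅ _) _ = min _ (0<x , <-≤-trans x<y (P.maximum _))

  -- Otherwise a < c and b < d would form an induced 2+2.
  interval-cross : P.IsIntervalOrder → ∀ {a b c d} → a < c → b < d → a < d ⊎ b < c
  interval-cross (I , I-<) a<c b<d
    with Equivalence.to (I-< _ _) a<c | Equivalence.to (I-< _ _) b<d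
  ... | q , a<q , q<c | r , b<r , r<d with ℚ.<-cmp q r
  ... | tri< q<r _ _  = inj₁ (Equivalence.from (I-< _ _)
        (q , a<q , Equivalence.from (ℝ.L-rounded (ClosedInterval.min (I _)) q) (r , q<r , r<d)))
  ... | tri≈ _ refl _ = inj₁ (Equivalence.from (I-< _ _) (q , a<q , r<d))
  ... | tri> _ _ r<q  = inj₂ (Equivalence.from (I-< _ _)
        (r , b<r , Equivalence.from (ℝ.L-rounded (ClosedInterval.min (I _)) r) (q , r<q , q<c)))

  -- The cover of `a` that witnesses `a ≺ b` is not above `b`, which excludes one alternative of
  -- `interval-cross`.
  ≺⇒upset⊆ : P.IsIntervalOrder → ∀ {a b x} → a ≺ b → b < x → a < x
  ≺⇒upset⊆ I (c , (a<c , _) , b≮c) b<x with interval-cross I a<c b<x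
  ... | inj₁ a<x = a<x
  ... | inj₂ b<c = contradiction b<c b≮c

  smallest-< : P.IsIntervalOrder → ∀ {a₀} → IsSmallestAtom a₀ → ∀ {b x} → IsAtom b → b < x → a₀ < x
  smallest-< I (_ , smallest) b-atom b<x with smallest _ b-atom
  ... | inj₁ a₀≺b = ≺⇒upset⊆ I a₀≺b b<x
  ... | inj₂ refl = b<x

-- The cone over `a₀` and the links of the other atoms

module Decomposition (P : BoundedPoset) (a₀ : BoundedPoset.Carrier P) (a₀-atom : BoundedPoset.IsAtom P a₀)
  (atom≢1̂ : ∀ {a} → BoundedPoset.IsAtom P a → a ≢ BoundedPoset.1̂ P)
  (a₀-< : ∀ {b x} → BoundedPoset.IsAtom P b → BoundedPoset._<_ P b x → BoundedPoset._<_ P a₀ x) where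

  open BoundedPoset P hiding (_≤_)
  private module P = BoundedPoset P
  open AtomLemmas P hiding (atom≢1̂)
  open IsFinite P.isFinite using (δ; δ-diag; δ-off)

  Proper : Carrier → Set
  Proper x = x ≢ 0̂ × x ≢ 1̂

  Other : Carrier → Set
  Other b = IsAtom b × b ≢ a₀

  other? : Unary.Decidable Other
  other? b = isAtom? b ×-dec ¬? (b ≟ a₀)

  others : List Carrier
  others = atomsExcept a₀

  proper : ∀ {a} → IsAtom a → Proper a
  proper a-atom = atom≢0̂ a-atom , atom≢1̂ a-atom

  classify : ∀ {x} → x ≢ 0̂ → a₀ < x ⊎ x ≡ a₀ ⊎ Other x
  classify {x} x≢0̂ with x ≟ a₀ | atom-below x≢0̂
  ... | yes x≡a₀ | _ = inj₂ (inj₁ x≡a₀)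
  ... | no x≢a₀ | a , a-atom , a≤x with a ≟ x
  ...   | yes refl = inj₂ (inj₂ (a-atom , x≢a₀))
  ...   | no a≢x   = inj₁ (a₀-< a-atom (a≤x , a≢x))

  χ : Carrier → ℤ
  χ x with a₀ <? x
  ... | yes _ = 1ℤ
  ... | no  _ = 0ℤ

  χ-yes : ∀ {x} → a₀ < x → χ x ≡ 1ℤ
  χ-yes {x} a₀<x with a₀ <? x
  ... | yes _ = refl
  ... | no a₀≮x = contradiction a₀<x a₀≮x

  χ-no : ∀ {x} → ¬ (a₀ < x) → χ x ≡ 0ℤ
  χ-no {x} a₀≮x with a₀ <? x
  ... | yes a₀<x = contradiction a₀<x a₀≮x
  ... | no _ = refl

  Functional : Set
  Functional = List Carrier → ℤ

  -- The transposes of φ, ψ and h below.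

  Φ Ψ : Carrier → Functional → Functional
  Φ b Θ []      = 0ℤ
  Φ b Θ (x ∷ v) = δ b x * Θ v
  Ψ b Θ v = Θ (b ∷ v) - Θ (a₀ ∷ v)

  H : Functional → Functional
  H Θ []      = Θ (a₀ ∷ [])
  H Θ (x ∷ v) = χ x * Θ (a₀ ∷ x ∷ v)

  H-cone : ∀ Θ {v} → All (a₀ <_) v → H Θ v ≡ Θ (a₀ ∷ v)
  H-cone Θ []          = refl
  H-cone Θ {x ∷ v} (a₀<x ∷ _) = trans (cong (_* Θ (a₀ ∷ x ∷ v)) (χ-yes a₀<x)) (ℤ.*-identityˡ _)

  -- Deleting the head leaves a list whose head lies above a proper element and so is not the atom
  -- `b`; `Φ b` kills that face. All other faces keep the head, and their signs are shifted by one.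
  ΦD≡-DΦ : ∀ {b} → IsAtom b → ∀ Θ {v} → AllPairs _<_ v → All Proper v → Φ b (D Θ) v ≡ - D (Φ b Θ) v
  ΦD≡-DΦ b-atom Θ [] _ = refl
  ΦD≡-DΦ {b} b-atom Θ {x ∷ v} (x<v ∷ _) ((x≢0̂ , _) ∷ _) = sym
    (trans (cong -_ (cong₂ _-_ (off x<v) (D-* (δ b x) Θ v))) (lemma (δ b x * D Θ v)))
    where
      off : ∀ {v} → All (x <_) v → Φ b Θ v ≡ 0ℤ
      off []        = refl
      off {y ∷ v} (x<y ∷ _) = cong (_* Θ v) (δ-off λ { refl → ≮-atom x≢0̂ b-atom x<y })
      lemma : ∀ a → - (0ℤ - a) ≡ a
      lemma = solve-∀

  -- Deleting `b` and deleting `a₀` both leave `v`, and these two faces cancel.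
  ΨD≡-DΨ : ∀ b Θ v → Ψ b (D Θ) v ≡ - D (Ψ b Θ) v
  ΨD≡-DΨ b Θ v = trans (lemma (Θ v) _ _) (cong -_ (sym (D-- (Θ ∘ (b ∷_)) (Θ ∘ (a₀ ∷_)) v)))
    where
      lemma : ∀ a b c → a - b - (a - c) ≡ - (b - c)
      lemma = solve-∀

  ΨΦ≡id : ∀ {b} → Other b → ∀ Θ v → Ψ b (Φ b Θ) v ≡ Θ v
  ΨΦ≡id {b} (_ , b≢a₀) Θ v =
    trans (cong₂ (λ s t → s * Θ v - t * Θ v) (δ-diag b) (δ-off b≢a₀)) (lemma (Θ v))
    where
      lemma : ∀ a → 1ℤ * a - 0ℤ * a ≡ a
      lemma = solve-∀

  ΨΦ≡0 : ∀ {b b′} → Other b → b ≢ b′ → ∀ Θ v → Ψ b′ (Φ b Θ) v ≡ 0ℤ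
  ΨΦ≡0 (_ , b≢a₀) b≢b′ Θ v = cong₂ (λ s t → s * Θ v - t * Θ v) (δ-off b≢b′) (δ-off b≢a₀)

  -- The transpose of the sum of the `ψ b ∘ φ b`; only the summand belonging to the head of the list
  -- can survive.
  ΣΦΨ : List Carrier → Functional → Functional
  ΣΦΨ []       Θ v = 0ℤ
  ΣΦΨ (b ∷ bs) Θ v = Φ b (Ψ b Θ) v + ΣΦΨ bs Θ v

  ΣΦΨ-∉ : ∀ {bs x} → All (_≢ x) bs → ∀ Θ v → ΣΦΨ bs Θ (x ∷ v) ≡ 0ℤ
  ΣΦΨ-∉ []          Θ v = refl
  ΣΦΨ-∉ (b≢x ∷ bs≢x) Θ v = cong₂ _+_ (cong (_* Ψ _ Θ v) (δ-off b≢x)) (ΣΦΨ-∉ bs≢x Θ v)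

  ΣΦΨ-∈ : ∀ {bs x} → Unique bs → x ∈ bs → ∀ Θ v → ΣΦΨ bs Θ (x ∷ v) ≡ Ψ x Θ v
  ΣΦΨ-∈ {x = x} (x∉ ∷ _) (here refl) Θ v =
    trans (cong₂ (λ s t → s * Ψ x Θ v + t) (δ-diag x) (ΣΦΨ-∉ (All.map (_∘ sym) x∉) Θ v)) (lemma (Ψ x Θ v))
    where
      lemma : ∀ a → 1ℤ * a + 0ℤ ≡ a
      lemma = solve-∀
  ΣΦΨ-∈ {b ∷ _} {x} (b∉ ∷ u) (there x∈) Θ v =
    trans (cong₂ (λ s t → s * Ψ b Θ v + t) (δ-off (All.lookup b∉ x∈)) (ΣΦΨ-∈ u x∈ Θ v)) (ℤ.+-identityˡ _)

  others-∈ : ∀ {b} → Other b → b ∈ others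
  others-∈ = ∈-filter⁺ other? (complete _)

  others-Other : All Other others
  others-Other = AllP.all-filter other? elements

  others-unique : Unique others
  others-unique = Unique.filter⁺ other? unique

  -- Deleting the other atoms leaves a cone with apex a₀, and coning with a₀ is the homotopy H.
  homotopy : ∀ Θ {x v} → AllPairs _<_ (x ∷ v) → All Proper (x ∷ v) →
    Θ (x ∷ v) ≡ H (D Θ) (x ∷ v) + D (H Θ) (x ∷ v) + ΣΦΨ others Θ (x ∷ v)
  homotopy Θ {x} {v} (x<v ∷ _) ((x≢0̂ , _) ∷ _) with classify x≢0̂
  ... | inj₁ a₀<x = sym (trans
        (cong₂ _+_ (cong₂ _+_ (H-cone (D Θ) a₀<xv) (D-cong {P = a₀ <_} (H-cone Θ) a₀<xv))
          (ΣΦΨ-∉ (All.map (λ { (b-atom , _) refl → ≮-atom (atom≢0̂ a₀-atom) b-atom a₀<x }) others-Other) Θ v))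
        (lemma (Θ (x ∷ v)) (D (Θ ∘ (a₀ ∷_)) (x ∷ v))))
    where
      a₀<xv : All (a₀ <_) (x ∷ v)
      a₀<xv = a₀<x ∷ All.map (<-trans a₀<x) x<v
      lemma : ∀ a b → a - b + b + 0ℤ ≡ a
      lemma = solve-∀
  -- Here `χ x` is 0, so `H` leaves only the face without `x`, coned to `a₀ ∷ v`; the term `Ψ x Θ v`
  -- trades this for `x ∷ v`.
  ... | inj₂ x-atom = sym (trans
        (cong₂ _+_ (cong₂ _+_ (cong (_* D Θ (a₀ ∷ x ∷ v)) χ≡0)
          (cong₂ _-_ (H-cone Θ a₀<v) (D-0 (λ u → cong (_* Θ (a₀ ∷ x ∷ u)) χ≡0) v)))
          (rest x-atom))
        (lemma (Θ (a₀ ∷ v)) (Θ (x ∷ v))))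
    where
      atom : x ≡ a₀ ⊎ Other x → IsAtom x
      atom (inj₁ refl)         = a₀-atom
      atom (inj₂ (x-atom , _)) = x-atom
      a₀<v : All (a₀ <_) v
      a₀<v = All.map (a₀-< (atom x-atom)) x<v
      χ≡0 : χ x ≡ 0ℤ
      χ≡0 = χ-no (≮-atom (atom≢0̂ a₀-atom) (atom x-atom))
      rest : x ≡ a₀ ⊎ Other x → ΣΦΨ others Θ (x ∷ v) ≡ Ψ x Θ v
      -- `Ψ a₀` is zero, so `a₀` obeys the same formula as the other atoms although it is absent
      -- from the sum.
      rest (inj₁ refl) = trans (ΣΦΨ-∉ (All.map proj₂ others-Other) Θ v) (sym (ℤ.+-inverseʳ (Θ (a₀ ∷ v))))
      rest (inj₂ x-other) = ΣΦΨ-∈ others-unique (others-∈ x-other) Θ v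
      lemma : ∀ a b → 0ℤ + (a - 0ℤ) + (b - a) ≡ b
      lemma = solve-∀

  -- The maps on chains and their transposes

  properPart-∈ : ∀ (x : FinitePoset.Carrier properPart) → Proper (value x)
  properPart-∈ (x , [ p ]) = recompute (¬? (x ≟ 0̂) ×-dec ¬? (x ≟ 1̂)) p

  properPart-onto : ∀ {x} → Proper x → ∃ λ (y : FinitePoset.Carrier properPart) → value y ≡ x
  properPart-onto {x} x∈ = (x , [ x∈ ]) , refl

  link : Carrier → FinitePoset
  link b = BoundedPoset.properPart (P [ b ,1̂])

  InLink : Carrier → Carrier → Set
  InLink b x = b < x × x ≢ 1̂

  link-ι : ∀ b → FinitePoset.Carrier (link b) → Carrier
  link-ι b x = value (value x)

  link-ι-injective : ∀ b {x y} → link-ι b x ≡ link-ι b y → x ≡ y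
  link-ι-injective b eq = value-injective (value-injective eq)

  link-∈ : ∀ b x → InLink b (link-ι b x)
  link-∈ b ((x , [ p ]) , [ q ]) =
    (recompute (b P.≤? x) (proj₁ p) , recompute (¬? (b ≟ x)) λ eq → proj₁ q (value-injective (sym eq))) ,
    recompute (¬? (x ≟ 1̂)) λ eq → proj₂ q (value-injective eq)

  link-onto : ∀ b {x} → InLink b x → ∃ λ y → link-ι b y ≡ x
  link-onto b {x} ((b≤x , b≢x) , x≢1̂) =
    ((x , [ (b≤x , P.maximum x) ]) ,
      [ ((λ eq → b≢x (sym (cong value eq))) , λ eq → x≢1̂ (cong value eq)) ]) , refl

  module P̄ = Subposet finitePoset properPart value value-injective id id Proper properPart-∈ properPart-onto

  module Link (b : Carrier) =
    Subposet finitePoset (link b) (link-ι b) (link-ι-injective b) id id (InLink b) (link-∈ b) (link-onto b)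

  module _ {k : ℕ} where

    φ : ∀ b → P̄.Chain (suc k) → Formal (Link.Chain b k)
    φ b σ = strip (P̄.elems σ)
      where
        strip : List Carrier → Formal (Link.Chain b k)
        strip []      = []
        strip (x ∷ v) = scale (δ b x) (Link.chain b k v)

    ψ : ∀ b → Link.Chain b k → Formal (P̄.Chain (suc k))
    ψ b τ = P̄.chain (suc k) (b ∷ Link.elems b τ) ++ scale -1ℤ (P̄.chain (suc k) (a₀ ∷ Link.elems b τ))

    h : P̄.Chain k → Formal (P̄.Chain (suc k))
    h σ = cone (P̄.elems σ)
      where
        cone : List Carrier → Formal (P̄.Chain (suc k))
        cone []      = P̄.chain (suc k) (a₀ ∷ [])
        cone (x ∷ v) = scale (χ x) (P̄.chain (suc k) (a₀ ∷ x ∷ v))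

    evalˡ-φ : ∀ b Θ σ → Link.evalˡ b Θ (φ b σ) ≡ Φ b Θ (P̄.elems σ)
    evalˡ-φ b Θ σ with P̄.elems σ | P̄.elems-length σ | P̄.elems-increasing σ | P̄.elems-∈ σ
    ... | x ∷ v | len | x<v ∷ inc | _ ∷ v∈ =
      trans (eval-scale _ (δ b x) (Link.chain b k v)) (guarded (b ≟ x))
      where
        -- If `b ≢ x`, the tail need not be a chain of the link and the two evaluations may differ;
        -- the factor 0 hides this.
        guarded : Dec (b ≡ x) → δ b x * Link.evalˡ b Θ (Link.chain b k v) ≡ δ b x * Θ v
        guarded (yes refl) = cong (δ b x *_) (Link.evalˡ-chain b Θ (ℕ.suc-injective len) inc
          (All.zipWith (λ (b<y , _ , y≢1̂) → b<y , y≢1̂) (x<v , v∈)))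
        guarded (no b≢x) rewrite δ-off b≢x = refl

    -- Both lists are genuine chains: whatever lies above `b` lies above `a₀` by `a₀-<`, so neither
    -- term of `ψ b` degenerates to 0.
    evalˡ-ψ : ∀ {b} → Other b → ∀ Θ τ → P̄.evalˡ Θ (ψ b τ) ≡ Ψ b Θ (Link.elems b τ)
    evalˡ-ψ {b} (b-atom , _) Θ τ = trans
      (eval-++ _ (P̄.chain (suc k) (b ∷ l)) _)
      (cong₂ _+_ (coned b-atom (All.map proj₁ l∈))
        (trans (eval-scale _ -1ℤ (P̄.chain (suc k) (a₀ ∷ l)))
        (trans (ℤ.-1*i≡-i _) (cong -_ (coned a₀-atom (All.map (a₀-< b-atom ∘ proj₁) l∈))))))
      where
        l = Link.elems b τ
        l∈ = Link.elems-∈ b τ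
        coned : ∀ {a} → IsAtom a → All (a <_) l → P̄.evalˡ Θ (P̄.chain (suc k) (a ∷ l)) ≡ Θ (a ∷ l)
        coned a-atom a<l = P̄.evalˡ-chain Θ (cong suc (Link.elems-length b τ)) (a<l ∷ Link.elems-increasing b τ)
          (proper a-atom ∷ All.map
            (λ { (b<x , x≢1̂) → (λ { refl → <-irrefl (<-≤-trans b<x (P.minimum b)) }) , x≢1̂ }) l∈)

    evalˡ-h : ∀ Θ σ → P̄.evalˡ Θ (h σ) ≡ H Θ (P̄.elems σ)
    evalˡ-h Θ σ with P̄.elems σ | P̄.elems-length σ | P̄.elems-increasing σ | P̄.elems-∈ σ
    ... | [] | len | _ | _ = P̄.evalˡ-chain Θ (cong suc len) ([] ∷ []) (proper a₀-atom ∷ [])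
    ... | x ∷ v | len | x<v ∷ inc | v∈ =
      trans (eval-scale _ (χ x) (P̄.chain (suc k) (a₀ ∷ x ∷ v))) (guarded (a₀ <? x))
      where
        guarded : Dec (a₀ < x) → χ x * P̄.evalˡ Θ (P̄.chain (suc k) (a₀ ∷ x ∷ v)) ≡ χ x * Θ (a₀ ∷ x ∷ v)
        guarded (yes a₀<x) = cong (χ x *_) (P̄.evalˡ-chain Θ (cong suc len)
          ((a₀<x ∷ All.map (<-trans a₀<x) x<v) ∷ x<v ∷ inc) (proper a₀-atom ∷ v∈))
        guarded (no a₀≮x) rewrite χ-no a₀≮x = refl

    evalˡ-extend-φ : ∀ b Θ c → Link.evalˡ b Θ (extend (φ b) c) ≡ P̄.evalˡ (Φ b Θ) c
    evalˡ-extend-φ b Θ c = trans (eval-extend _ (φ b) c) (eval-cong (evalˡ-φ b Θ) c)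

    evalˡ-extend-ψ : ∀ {b} → Other b → ∀ Θ c → P̄.evalˡ Θ (extend (ψ b) c) ≡ Link.evalˡ b (Ψ b Θ) c
    evalˡ-extend-ψ {b} b-other Θ c = trans (eval-extend _ (ψ b) c) (eval-cong (evalˡ-ψ b-other Θ) c)

    evalˡ-extend-h : ∀ Θ c → P̄.evalˡ Θ (extend h c) ≡ P̄.evalˡ (H Θ) c
    evalˡ-extend-h Θ c = trans (eval-extend _ h c) (eval-cong (evalˡ-h Θ) c)

    -- Transposition reverses the composite, which leaves `ΨΦ≡id` to be applied on lists.
    φψ≐id : ∀ {b} → Other b → ∀ c → extend (φ b) (extend (ψ b) c) ≐ c
    φψ≐id {b} b-other c = Link.evalˡ-≐ b (extend (φ b) (extend (ψ b) c)) c λ Θ →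
      trans (evalˡ-extend-φ b Θ (extend (ψ b) c))
      (trans (evalˡ-extend-ψ b-other (Φ b Θ) c) (eval-cong (λ τ → ΨΦ≡id b-other Θ (Link.elems b τ)) c))

    φψ≐0 : ∀ {b b′} → Other b → Other b′ → b ≢ b′ → ∀ c → extend (φ b) (extend (ψ b′) c) ≐ []
    φψ≐0 {b} {b′} b-other b′-other b≢b′ c = Link.evalˡ-≐ b (extend (φ b) (extend (ψ b′) c)) [] λ Θ →
      trans (evalˡ-extend-φ b Θ (extend (ψ b′) c))
      (trans (evalˡ-extend-ψ b′-other (Φ b Θ) c) (eval-0 (λ τ → ΨΦ≡0 b-other b≢b′ Θ (Link.elems b′ τ)) c))

  -- Passage to homology

  evalˡ-ΦD : ∀ {k b} → Other b → ∀ Θ (c : Formal (P̄.Chain k)) →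
    P̄.evalˡ (Φ b (D Θ)) c ≡ - P̄.evalˡ (D (Φ b Θ)) c
  evalˡ-ΦD (b-atom , _) Θ c = trans
    (eval-cong (λ σ → ΦD≡-DΦ b-atom Θ (P̄.elems-increasing σ) (P̄.elems-∈ σ)) c) (eval-neg _ c)

  evalˡ-ΨD : ∀ {k} b Θ (c : Formal (Link.Chain b k)) →
    Link.evalˡ b (Ψ b (D Θ)) c ≡ - Link.evalˡ b (D (Ψ b Θ)) c
  evalˡ-ΨD b Θ c = trans (eval-cong (λ τ → ΨD≡-DΨ b Θ (Link.elems b τ)) c) (eval-neg _ c)

  module _ (k : ℕ) where

    φ-cycle : ∀ {b} → Other b → ∀ {c} → ChainCycles properPart (suc k) c →
      ChainCycles (link b) k (extend (φ b) c)
    φ-cycle {b} b-other {c} c-cycle = Link.cycle⁺ b k (extend (φ b) c) λ Θ →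
      trans (evalˡ-extend-φ b (D Θ) c)
      (trans (evalˡ-ΦD b-other Θ c) (cong -_ (P̄.cycle⁻ (suc k) c c-cycle (Φ b Θ))))

    ψ-cycle : ∀ {b} → Other b → ∀ {c} → ChainCycles (link b) k c →
      ChainCycles properPart (suc k) (extend (ψ b) c)
    ψ-cycle {b} b-other {c} c-cycle = P̄.cycle⁺ (suc k) (extend (ψ b) c) λ Θ →
      trans (evalˡ-extend-ψ b-other (D Θ) c)
      (trans (evalˡ-ΨD b Θ c) (cong -_ (Link.cycle⁻ b k c c-cycle (Ψ b Θ))))

    φ-boundary : ∀ {b} → Other b → ∀ {c} → ChainBoundaries properPart (suc k) c →
      ChainBoundaries (link b) k (extend (φ b) c)
    -- The scalar -1 in the witness compensates for the anticommutation of `φ b` with the boundary.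
    φ-boundary {b} b-other {c} c-bd@(w , _) = Link.boundary⁺ b k (extend (φ b) c) (scale -1ℤ (extend (φ b) w))
      λ Θ → begin
      Link.evalˡ b Θ (extend (φ b) c)                  ≡⟨ evalˡ-extend-φ b Θ c ⟩
      P̄.evalˡ (Φ b Θ) c                               ≡⟨ P̄.boundary⁻ (suc k) c c-bd (Φ b Θ) ⟩
      P̄.evalˡ (D (Φ b Θ)) w                           ≡⟨ ℤ.neg-involutive _ ⟨
      - - P̄.evalˡ (D (Φ b Θ)) w                       ≡⟨ cong -_ (evalˡ-ΦD b-other Θ w) ⟨
      - P̄.evalˡ (Φ b (D Θ)) w                         ≡⟨ cong -_ (evalˡ-extend-φ b (D Θ) w) ⟨
      - Link.evalˡ b (D Θ) (extend (φ b) w)            ≡⟨ ℤ.-1*i≡-i _ ⟨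
      -1ℤ * Link.evalˡ b (D Θ) (extend (φ b) w)        ≡⟨ eval-scale _ -1ℤ (extend (φ b) w) ⟨
      Link.evalˡ b (D Θ) (scale -1ℤ (extend (φ b) w))  ∎
      where open ≡-Reasoning

    -- If `φ b c` bounds `u`, then `ψ b (φ b c)` bounds the negative of `ψ b u`; the witness
    -- collects these over `bs`.
    evalˡ-ΣΦΨ : ∀ bs → All Other bs → ∀ c →
      (∀ {b} → b ∈ bs → ChainBoundaries (link b) k (extend (φ b) c)) →
      ∃ λ w → ∀ Θ → P̄.evalˡ (ΣΦΨ bs Θ) c ≡ P̄.evalˡ (D Θ) w
    evalˡ-ΣΦΨ [] [] c _ = [] , λ Θ → eval-0 (λ _ → refl) c
    evalˡ-ΣΦΨ (b ∷ bs) (b-other ∷ bs-other) c bd with evalˡ-ΣΦΨ bs bs-other c (bd ∘ there) | bd (here refl)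
    ... | w , w-bd | b-bd@(u , _) = scale -1ℤ (extend (ψ b) u) ++ w , λ Θ → begin
      P̄.evalˡ (ΣΦΨ (b ∷ bs) Θ) c
        ≡⟨ eval-+ _ _ c ⟩
      P̄.evalˡ (Φ b (Ψ b Θ)) c + P̄.evalˡ (ΣΦΨ bs Θ) c
        ≡⟨ cong₂ _+_ (first Θ) (w-bd Θ) ⟩
      -1ℤ * P̄.evalˡ (D Θ) (extend (ψ b) u) + P̄.evalˡ (D Θ) w
        ≡⟨ eval-scale-++ _ -1ℤ (extend (ψ b) u) w ⟨
      P̄.evalˡ (D Θ) (scale -1ℤ (extend (ψ b) u) ++ w)
        ∎
      where
        open ≡-Reasoning
        first : ∀ Θ → P̄.evalˡ (Φ b (Ψ b Θ)) c ≡ -1ℤ * P̄.evalˡ (D Θ) (extend (ψ b) u)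
        first Θ = begin
          P̄.evalˡ (Φ b (Ψ b Θ)) c                ≡⟨ evalˡ-extend-φ b (Ψ b Θ) c ⟨
          Link.evalˡ b (Ψ b Θ) (extend (φ b) c)   ≡⟨ Link.boundary⁻ b k (extend (φ b) c) b-bd (Ψ b Θ) ⟩
          Link.evalˡ b (D (Ψ b Θ)) u              ≡⟨ ℤ.neg-involutive _ ⟨
          - - Link.evalˡ b (D (Ψ b Θ)) u          ≡⟨ cong -_ (evalˡ-ΨD b Θ u) ⟨
          - Link.evalˡ b (Ψ b (D Θ)) u            ≡⟨ cong -_ (evalˡ-extend-ψ b-other (D Θ) u) ⟨
          - P̄.evalˡ (D Θ) (extend (ψ b) u)       ≡⟨ ℤ.-1*i≡-i _ ⟨
          -1ℤ * P̄.evalˡ (D Θ) (extend (ψ b) u)   ∎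

    -- For a cycle the term h∂ of the homotopy vanishes, ∂h is a boundary, and the sum of the
    -- `ψ b (φ b c)` is one by `evalˡ-ΣΦΨ`.
    φ-injective : ∀ c → ChainCycles properPart (suc k) c →
      (∀ {b} → b ∈ others → ChainBoundaries (link b) k (extend (φ b) c)) →
      ChainBoundaries properPart (suc k) c
    φ-injective c c-cycle bd with evalˡ-ΣΦΨ others others-Other c bd
    ... | w , w-bd = P̄.boundary⁺ (suc k) c (extend h c ++ w) λ Θ → begin
      P̄.evalˡ Θ c
        ≡⟨ eval-cong (λ σ → homotopyᶜ Θ σ) c ⟩
      eval (λ σ → H (D Θ) (P̄.elems σ) + D (H Θ) (P̄.elems σ) + ΣΦΨ others Θ (P̄.elems σ)) c
        ≡⟨ trans (eval-+ _ _ c) (cong (_+ P̄.evalˡ (ΣΦΨ others Θ) c) (eval-+ _ _ c)) ⟩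
      P̄.evalˡ (H (D Θ)) c + P̄.evalˡ (D (H Θ)) c + P̄.evalˡ (ΣΦΨ others Θ) c
        ≡⟨ cong₂ _+_ (cong₂ _+_ (sym (evalˡ-extend-h (D Θ) c)) (P̄.cycle⁻ (suc k) c c-cycle (H Θ))) (w-bd Θ) ⟩
      P̄.evalˡ (D Θ) (extend h c) + 0ℤ + P̄.evalˡ (D Θ) w
        ≡⟨ cong (_+ P̄.evalˡ (D Θ) w) (ℤ.+-identityʳ (P̄.evalˡ (D Θ) (extend h c))) ⟩
      P̄.evalˡ (D Θ) (extend h c) + P̄.evalˡ (D Θ) w
        ≡⟨ eval-++ _ (extend h c) w ⟨
      P̄.evalˡ (D Θ) (extend h c ++ w)
        ∎
      where
        open ≡-Reasoning
        homotopyᶜ : ∀ Θ (σ : P̄.Chain (suc k)) → Θ (P̄.elems σ) ≡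
          H (D Θ) (P̄.elems σ) + D (H Θ) (P̄.elems σ) + ΣΦΨ others Θ (P̄.elems σ)
        homotopyᶜ Θ σ with P̄.elems σ | P̄.elems-length σ | P̄.elems-increasing σ | P̄.elems-∈ σ
        ... | x ∷ v | _ | inc | v∈ = homotopy Θ inc v∈

    -- The rank chosen by `hasRank` is abstract; uniqueness of ranks identifies it with the sum
    -- built from the links.
    rank-decomposition :
      proj₁ (OrderComplex.hasRank (BoundedPoset.properPart P) (suc k)) ≡
      sum (map (λ b → proj₁ (OrderComplex.hasRank (BoundedPoset.properPart (P [ b ,1̂])) k)) others)
    rank-decomposition = RankModulo-unique (hasRankModulo properPart (suc k))
      (rank-sum φ ψ {A′ = λ b → ChainCycles (link b) k} {N′ = λ b → ChainBoundaries (link b) k}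
        (λ b → ChainBoundaries-isSubgroup (link b) k) (λ b → hasRankModulo (link b) k)
        φψ≐id φψ≐0 others-unique others-Other
        (ChainCycles-isSubgroup properPart (suc k)) (ChainBoundaries-isSubgroup properPart (suc k))
        (λ b-other {c} → φ-cycle b-other {c})
        (All.map (λ b-other {c} → ψ-cycle b-other {c}) others-Other)
        (λ b-other {c} → φ-boundary b-other {c})
        φ-injective)

corollary12 : (P : BoundedPoset) →
    BoundedPoset.IsIntervalOrder P →
    (ℓ : ℕ) → BoundedPoset.HasLength P ℓ → 2 Data.Nat.≤ ℓ →
    (a₀ : BoundedPoset.Carrier P) → BoundedPoset.IsSmallestAtom P a₀ →
    (i : ℤ) → 0ℤ ≤ i →
    β i P ≡ sum (map (λ a → β (i - 1ℤ) (P [ a ,1̂])) (BoundedPoset.atomsExcept P a₀))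
corollary12 P interval ℓ len 2≤ℓ a₀ smallest = λ where
    -- The split lets `i - 1ℤ` compute: `β` has separate clauses at -1 and at `+ k`, which use
    -- chains of 0 and of `suc k` elements.
    (+ zero)  _ → rank-decomposition 0
    (+ suc k) _ → rank-decomposition (suc k)
  where open Decomposition P a₀ (proj₁ smallest) (AtomLemmas.atom≢1̂ P len 2≤ℓ)
          (AtomLemmas.smallest-< P interval smallest)
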